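{- Let $P\in N_1$ be a sum of $10$ monomials, not necessarily distinct (i.e. $P(1)=10$). If $P$ does not have unique factorisation inside $N_1$, then one of the following holds. (A) There are integers $c\ge0$, $d\ge1$ such that $P(X)=X^cQ(X^d)$, where $Q$ is one of $Q_1=(1+X)(1+X^2+X^4+X^6+X^8)=(1+X^5)(1+X+X^2+X^3+X^4)$, $Q_2=(1+X)(1+X^4+X^6+X^8+X^{12})=(1+X^5)(1+X+X^4+X^7+X^8)$, $Q_3=(1+X^3)(1+X^2+X^4+X^6+X^8)=(1+X^5)(1+X^2+X^3+X^4+X^6)$. (B) There are integers $c\ge0$, $a\ge0$, $b\ge1$ such that $P=X^c\cdot F$, where $F$ is one of $(1+X^{3b})(1+X^a+X^b+X^{a+b}+X^{a+2b})=(1+X^b)(1+X^a+X^{a+2b}+X^{3b}+X^{a+4b})$, $(1+X^{3b})(1+X^a+X^b+X^{a+b}+X^{2b})=(1+X^b)(1+X^a+X^{2b}+X^{a+3b}+X^{4b})$.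
   Context: $N_1=\mathbb{Z}_{\ge0}[X]$ is the semiring of univariate polynomials with nonnegative integer coefficients. An element $Q\neq0,1$ of $N_1$ is irreducible if in every factorisation $Q=ST$ with $S,T\in N_1$ one of $S,T$ is $1$. $P$ has unique factorisation in $N_1$ if any two factorisations of $P$ into irreducibles of $N_1$ coincide up to order of the factors. -}

module Defs where

open import Data.List.Base using (List; []; _∷_; foldr; map)
open import Data.List.Relation.Unary.All using (All)
import Data.List.Relation.Binary.Permutation.Setoid as Permutation
open import Data.Nat.Base using (ℕ; zero; suc; _+_; _*_)
open import Data.Product.Base using (_×_)
open import Data.Sum.Base using (_⊎_)
open import Level using (0ℓ)
open import Relation.Binary.Bundles using (Setoid)
open import Relation.Binary.PropositionalEquality using (_≡_; refl; sym; trans)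
open import Relation.Nullary.Negation using (¬_)

infix  4 _≈_
infixl 6 _⊕_
infixl 7 _⊗_ _·_
infixl 8 _⟨_⟩

-- Coefficient lists, constant term first.  Trailing zeros are allowed, so the
-- equality of polynomials is _≈_ below rather than _≡_.
N₁ : Set
N₁ = List ℕ

coeff : N₁ → ℕ → ℕ
coeff []      _       = 0
coeff (a ∷ p) zero    = a
coeff (a ∷ p) (suc i) = coeff p i

-- A record rather than a function, so that p and q can be inferred from p ≈ q.
record _≈_ (p q : N₁) : Set where
  constructor mk≈
  field
    coeff-≡ : ∀ i → coeff p i ≡ coeff q i

open _≈_ public

N₁-setoid : Setoid 0ℓ 0ℓ
N₁-setoid = record
  { Carrier       = N₁
  ; _≈_           = _≈_
  ; isEquivalence = record
    { refl  = mk≈ λ _ → refl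
    ; sym   = λ e → mk≈ λ i → sym (coeff-≡ e i)
    ; trans = λ e f → mk≈ λ i → trans (coeff-≡ e i) (coeff-≡ f i)
    }
  }

open Permutation N₁-setoid public using (_↭_)

0# : N₁
0# = []

1# : N₁
1# = 1 ∷ []

_⊕_ : N₁ → N₁ → N₁
[]      ⊕ q       = q
(a ∷ p) ⊕ []      = a ∷ p
(a ∷ p) ⊕ (b ∷ q) = (a + b) ∷ (p ⊕ q)

_·_ : ℕ → N₁ → N₁
a · p = map (a *_) p

-- (a + X p) q = a q + X (p q)
_⊗_ : N₁ → N₁ → N₁
[]      ⊗ q = []
(a ∷ p) ⊗ q = (a · q) ⊕ (0 ∷ (p ⊗ q))

X^ : ℕ → N₁
X^ zero    = 1#
X^ (suc n) = 0 ∷ X^ n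

eval : N₁ → ℕ → ℕ
eval []      x = 0
eval (a ∷ p) x = a + x * eval p x

-- Composition of polynomials, by Horner's rule: p ⟨ q ⟩ is p(q(X)).
_⟨_⟩ : N₁ → N₁ → N₁
[]      ⟨ q ⟩ = 0#
(a ∷ p) ⟨ q ⟩ = (a ∷ []) ⊕ q ⊗ p ⟨ q ⟩

Irreducible : N₁ → Set
Irreducible Q =
  ¬ (Q ≈ 0#) × ¬ (Q ≈ 1#) × (∀ S T → Q ≈ S ⊗ T → S ≈ 1# ⊎ T ≈ 1#)

∏ : List N₁ → N₁
∏ = foldr _⊗_ 1#

_IsIrreducibleFactorisationOf_ : List N₁ → N₁ → Set
Qs IsIrreducibleFactorisationOf P = All Irreducible Qs × P ≈ ∏ Qs

UniqueFactorisation : N₁ → Set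
UniqueFactorisation P = ∀ Qs Rs →
  Qs IsIrreducibleFactorisationOf P → Rs IsIrreducibleFactorisationOf P → Qs ↭ Rs

-- The exceptional polynomials are displayed together with both of their
-- factorisations, so Q ≈[ L ≈ R ] says that Q equals each of L and R.
_≈[_≈_] : N₁ → N₁ → N₁ → Set
Q ≈[ L ≈ R ] = Q ≈ L × Q ≈ R

SporadicQ : N₁ → Set
SporadicQ Q =
    Q ≈[ (1# ⊕ X^ 1) ⊗ (1# ⊕ X^ 2 ⊕ X^ 4 ⊕ X^ 6 ⊕ X^ 8)
       ≈ (1# ⊕ X^ 5) ⊗ (1# ⊕ X^ 1 ⊕ X^ 2 ⊕ X^ 3 ⊕ X^ 4) ]
  ⊎ Q ≈[ (1# ⊕ X^ 1) ⊗ (1# ⊕ X^ 4 ⊕ X^ 6 ⊕ X^ 8 ⊕ X^ 12)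
       ≈ (1# ⊕ X^ 5) ⊗ (1# ⊕ X^ 1 ⊕ X^ 4 ⊕ X^ 7 ⊕ X^ 8) ]
  ⊎ Q ≈[ (1# ⊕ X^ 3) ⊗ (1# ⊕ X^ 2 ⊕ X^ 4 ⊕ X^ 6 ⊕ X^ 8)
       ≈ (1# ⊕ X^ 5) ⊗ (1# ⊕ X^ 2 ⊕ X^ 3 ⊕ X^ 4 ⊕ X^ 6) ]

FamilyF : ℕ → ℕ → N₁ → Set
FamilyF a b F =
    F ≈[ (1# ⊕ X^ (3 * b)) ⊗ (1# ⊕ X^ a ⊕ X^ b ⊕ X^ (a + b) ⊕ X^ (a + 2 * b))
       ≈ (1# ⊕ X^ b) ⊗ (1# ⊕ X^ a ⊕ X^ (a + 2 * b) ⊕ X^ (3 * b) ⊕ X^ (a + 4 * b)) ]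
  ⊎ F ≈[ (1# ⊕ X^ (3 * b)) ⊗ (1# ⊕ X^ a ⊕ X^ b ⊕ X^ (a + b) ⊕ X^ (2 * b))
       ≈ (1# ⊕ X^ b) ⊗ (1# ⊕ X^ a ⊕ X^ (2 * b) ⊕ X^ (a + 3 * b) ⊕ X^ (4 * b)) ]

{-# OPTIONS --safe #-}
module Submission where

open import Defs
open import Data.Nat.Base using (ℕ; _≥_)
open import Data.Product.Base using (_×_; ∃-syntax)
open import Data.Sum.Base using (_⊎_)
open import Relation.Binary.PropositionalEquality using (_≡_)
open import Relation.Nullary.Negation using (¬_)
open import Algebra.Bundles using (CommutativeMonoid)
import Algebra.Properties.AbelianGroup as AbelianGroupProperties
import Algebra.Properties.CommutativeSemigroup as CommutativeSemigroupProperties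
open import Algebra.Structures using (IsCommutativeMonoid)
open import Algebra.Structures.Biased using (isCommutativeMonoidˡ)
open import Data.Empty using (⊥; ⊥-elim)
open import Data.Integer.Base as ℤ using (ℤ; +_; -_; ∣_∣)
import Data.Integer.Properties as ℤₚ
open import Data.Integer.Tactic.RingSolver using (solve-∀)
open import Data.List.Base
  using (List; []; _∷_; [_]; _++_; map; length; replicate; upTo; cartesianProductWith)
open import Data.List.Membership.Propositional using (_∈_; find; lose)
open import Data.List.Membership.Propositional.Properties
  using (∈-map⁻; ∈-upTo⁺; ∈-cartesianProductWith⁺)
import Data.List.Properties as Listₚ
open import Data.List.Relation.Binary.Permutation.Propositional
  using (prep; swap; ↭-refl; ↭-sym; ↭-trans; ↭-reflexive)
  renaming (_↭_ to _↭ₚ_)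
import Data.List.Relation.Binary.Permutation.Propositional.Properties as Perm
import Data.List.Relation.Binary.Permutation.Setoid as SetoidPermutation
import Data.List.Relation.Binary.Permutation.Setoid.Properties as SetoidPermutationProperties
open import Data.List.Relation.Unary.All using (All; []; _∷_; all?; lookup; tabulate)
open import Data.List.Relation.Unary.Any as Any using (Any; here; there; any?; _─_)
open import Data.Nat.Base as ℕ using (zero; suc; z≤n; s≤s; _<_)
open import Data.Nat.Coprimality using (coprime-divisor; coprime?)
open import Data.Nat.Divisibility using (divides)
import Data.Nat.Properties as ℕₚ
open import Data.Nat.Tactic.RingSolver using () renaming (solve-∀ to ℕ-solve-∀)
open import Data.Product.Base using (_,_; proj₁; proj₂)
open import Data.Product.Properties using (≡-dec)
open import Data.Sign.Base as Sign using (Sign)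
open import Data.Sum.Base using (inj₁; inj₂; [_,_]′)
open import Level using (0ℓ)
open import Relation.Binary.Bundles using (Setoid)
open import Relation.Binary.Definitions using (DecidableEquality; tri<; tri≈; tri>)
open import Relation.Binary.PropositionalEquality
  using (_≢_; refl; sym; trans; cong; cong₂; subst; subst₂; module ≡-Reasoning)
import Relation.Binary.Reasoning.Setoid as SetoidReasoning
open import Relation.Nullary.Decidable
  using (Dec; yes; no; True; toWitness; from-yes; map′; _×-dec_; _⊎-dec_; _→-dec_)
open import Relation.Nullary.Negation using (contradiction)

-- Since 10 = 2 · 5 and only powers of X have value 1 at 1, a factorisation of P is
-- determined by powers of X, possibly a binomial factor 1 + X^m, and its cofactor.
-- If P has two binomial factors, with m < n, then its 10 exponents are matched in
-- pairs differing by m, and also in pairs differing by n.  Following the two matchings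
-- alternately decomposes the exponents into closed walks.  A walk through 2ℓ exponents
-- gives s m + t n = 0 with |s|, |t| ≤ ℓ and s ≡ t ≡ ℓ (mod 2), and as the ℓ's sum to 5
-- one of them is odd.  Hence m : n is 1 : 3, 1 : 5 or 3 : 5, the walks have lengths 5
-- or 3 + 2, and a finite enumeration of step signs yields the exponents.

-- The negation of uniqueness hands over no factorisations, so two binomial factors cannot be read
-- off from it. Instead `Ambiguous (exps P)` is decided by a finite search, and its failure is shown
-- to imply unique factorisation. The parity of a walk matters because an even closed walk may have
-- both nets zero and then says nothing about `m` and `n`; only an odd one yields a relation between
-- them. Exponents may coincide, so matchings are expressed as permutations of multisets, and the
-- enumeration also admits walks that revisit a point. Walks go down as well as up and are therefore
-- followed in the integers. Natural offsets are recovered at the end because every resulting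
-- pattern contains its own offset.

private
  variable
    A B : Set

-- Multisets as lists up to permutation

remove-↭ : {x : A} {xs : List A} (x∈xs : x ∈ xs) → xs ↭ₚ x ∷ (xs ─ x∈xs)
remove-↭ (here refl)            = ↭-refl
remove-↭ {xs = y ∷ _} (there p) = ↭-trans (prep y (remove-↭ p)) (swap y _ ↭-refl)

-- Committing to the first occurrence of `x` loses nothing, since a permutation can be cancelled at
-- any occurrence.
permutation? : DecidableEquality A → (xs ys : List A) → Dec (xs ↭ₚ ys)
permutation? _≟_ []       []      = yes ↭-refl
permutation? _≟_ []       (y ∷ _) = no λ p → contradiction (Perm.↭-length p) λ ()
permutation? _≟_ (x ∷ xs) ys with any? (x ≟_) ys
... | no  x∉ys = no λ p → x∉ys (Perm.∈-resp-↭ p (here refl))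
... | yes x∈ys = map′
  (λ p → ↭-trans (prep x p) (↭-sym (remove-↭ x∈ys)))
  (λ p → Perm.drop-∷ (↭-trans p (remove-↭ x∈ys)))
  (permutation? _≟_ xs (ys ─ x∈ys))

tuples : List A → ℕ → List (List A)
tuples xs zero    = [] ∷ []
tuples xs (suc k) = cartesianProductWith _∷_ xs (tuples xs k)

∈-tuples : {xs ys : List A} → All (_∈ xs) ys → ys ∈ tuples xs (length ys)
∈-tuples []       = here refl
∈-tuples (p ∷ ps) = ∈-cartesianProductWith⁺ _∷_ p (∈-tuples ps)

pairs : (A → A) → List A → List A
pairs f []       = []
pairs f (x ∷ xs) = x ∷ f x ∷ pairs f xs

module _ (f : A → A) where

  ∈-pairs : ∀ {x xs} → x ∈ xs → x ∈ pairs f xs × f x ∈ pairs f xs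
  ∈-pairs (here refl) = here refl , there (here refl)
  ∈-pairs (there p) with q , r ← ∈-pairs p = there (there q) , there (there r)

  length-pairs : ∀ xs → length (pairs f xs) ≡ length xs ℕ.* 2
  length-pairs []       = refl
  length-pairs (x ∷ xs) = cong (2 ℕ.+_) (length-pairs xs)

map-pairs : {f : A → A} {g : B → B} (h : A → B) → (∀ x → h (f x) ≡ g (h x)) →
            ∀ xs → map h (pairs f xs) ≡ pairs g (map h xs)
map-pairs h eq []       = refl
map-pairs h eq (x ∷ xs) = cong₂ (λ y ys → h x ∷ y ∷ ys) (eq x) (map-pairs h eq xs)

-- Alternating walks

-- A point z of pairs (m +_) B is either an element of B (sign +) or a translate
-- m + x of one (sign -).
base partner : Sign → ℤ → ℤ → ℤ
base Sign.+ m z = z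
base Sign.- m z = z ℤ.- m
partner Sign.+ m z = m ℤ.+ z
partner Sign.- m z = z ℤ.- m

-- Opaque, here and below, because with-abstraction would otherwise normalise the
-- solver-generated proofs and the enumerations.
opaque
  translate-cancel : ∀ m x → m ℤ.+ x ℤ.- m ≡ x
  translate-cancel = solve-∀

extract : ∀ m {z} B → z ∈ pairs (ℤ._+_ m) B → ∃[ s ] ∃[ B₀ ]
  (B ↭ₚ base s m z ∷ B₀ × pairs (ℤ._+_ m) B ↭ₚ z ∷ partner s m z ∷ pairs (ℤ._+_ m) B₀)
extract m (x ∷ B) (here refl) = Sign.+ , B , ↭-refl , ↭-refl
extract m (x ∷ B) (there (here refl)) = Sign.- , B ,
  ↭-reflexive (cong (_∷ B) (sym (translate-cancel m x))) ,
  ↭-trans (swap x _ ↭-refl)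
    (↭-reflexive (cong (λ y → (m ℤ.+ x) ∷ y ∷ _) (sym (translate-cancel m x))))
extract m {z} (x ∷ B) (there (there z∈)) with s , B₀ , p , q ← extract m B z∈ =
  s , x ∷ B₀ , ↭-trans (prep x p) (swap x _ ↭-refl) ,
  ↭-trans (prep x (prep _ q)) (Perm.shifts (x ∷ _ ∷ []) (z ∷ partner s m z ∷ []))

-- An entry `(δ , ε)` is a double step, along an `n`-pair and then along an `m`-pair. It uses up
-- exactly one element of `B`, so the length counts elements of `B`.
Steps : Set
Steps = List (Sign × Sign)

end : ℤ → ℤ → Steps → ℤ → ℤ
end m n []            u = u
end m n ((δ , ε) ∷ σ) u = end m n σ (partner ε m (partner δ n u))

bases : ℤ → ℤ → Steps → ℤ → List ℤ
bases m n []            u = []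
bases m n ((δ , ε) ∷ σ) u =
  base ε m (partner δ n u) ∷ bases m n σ (partner ε m (partner δ n u))

length-bases : ∀ m n σ u → length (bases m n σ u) ≡ length σ
length-bases m n []      u = refl
length-bases m n (_ ∷ σ) u = cong suc (length-bases m n σ _)

record Walk (m n u v : ℤ) (B : List ℤ) : Set where
  constructor mkWalk
  field
    steps     : Steps
    rest rest′ : List ℤ
    ends      : end m n steps u ≡ v
    splits    : B ↭ₚ bases m n steps u ++ rest
    balanced  : pairs (ℤ._+_ m) rest ↭ₚ pairs (ℤ._+_ n) rest′

module _ (m n : ℤ) where
  opaque
    -- The extra `u` and `v` are the current point and the target. Cancelling the `n`-pair at `u`
    -- and then the `m`-pair at its partner restores the same form with a new `u`, so the walk can
    -- stop only at `v`. Each double step shortens `B`, which `k` bounds.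
    walk  : ∀ k {u v} B B′ → length B < k →
            u ∷ pairs (ℤ._+_ m) B ↭ₚ v ∷ pairs (ℤ._+_ n) B′ → Walk m n u v B
    -- Forces the first double step: a cycle begins with `u` equal to `v`, where `walk` would stop
    -- at once.
    walk⁺ : ∀ k {u v} B B′ → length B < k → u ∈ pairs (ℤ._+_ n) B′ →
            u ∷ pairs (ℤ._+_ m) B ↭ₚ v ∷ pairs (ℤ._+_ n) B′ →
            ∃[ w ] (Walk.steps {m} {n} {u} {v} {B} w ≢ [])

    walk k {u} B B′ |B|<k bal with Perm.∈-resp-↭ bal (here refl)
    ... | here refl = mkWalk [] B B′ refl ↭-refl (Perm.drop-∷ bal)
    ... | there u∈  = proj₁ (walk⁺ k B B′ |B|<k u∈ bal)

    walk⁺ (suc k) {u} {v} B B′ (s≤s |B|≤k) u∈ bal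
      with δ , B′₀ , _ , q ← extract n B′ u∈
      with bal₁ ← Perm.drop-∷ (↭-trans bal (↭-trans (prep v q) (swap v u ↭-refl)))
      with ε , B₀ , p , r ← extract m B (Perm.∈-resp-↭ (↭-sym bal₁) (there (here refl)))
      with mkWalk σ rest rest′ e s b ← walk k B₀ B′₀ (subst (ℕ._≤ k) (Perm.↭-length p) |B|≤k)
        (Perm.drop-∷ (↭-trans (↭-sym r) (↭-trans bal₁ (swap v _ ↭-refl))))
      = mkWalk ((δ , ε) ∷ σ) rest rest′ e (↭-trans p (prep _ s)) b , λ ()

    cycle : ∀ x B B′ → pairs (ℤ._+_ m) (x ∷ B) ↭ₚ pairs (ℤ._+_ n) B′ →
            ∃[ w ] (Walk.steps {m} {n} {x} {x} {x ∷ B} w ≢ [])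
    cycle x B B′ bal =
      -- A second copy of `x` on both sides makes it current point and target together.
      walk⁺ _ (x ∷ B) B′ (ℕₚ.n<1+n _) (Perm.∈-resp-↭ bal (here refl)) (prep x bal)

-- Closed walks

sign : Sign → ℤ
sign s = s ℤ.◃ 1

net : (Sign × Sign → Sign) → Steps → ℤ
net π []      = + 0
net π (s ∷ σ) = sign (π s) ℤ.+ net π σ

drift : ℤ → ℤ → Steps → ℤ
drift m n σ = net proj₁ σ ℤ.* n ℤ.+ net proj₂ σ ℤ.* m

opaque
  partner-≡ : ∀ s m z → partner s m z ≡ z ℤ.+ sign s ℤ.* m
  partner-≡ Sign.+ = eq
    where eq : ∀ m z → m ℤ.+ z ≡ z ℤ.+ + 1 ℤ.* m
          eq = solve-∀
  partner-≡ Sign.- = eq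
    where eq : ∀ m z → z ℤ.- m ≡ z ℤ.+ ℤ.-1ℤ ℤ.* m
          eq = solve-∀

opaque
  end-≡ : ∀ m n σ u → end m n σ u ≡ u ℤ.+ drift m n σ
  end-≡ m n []            u = eq m n u
    where eq : ∀ m n u → u ≡ u ℤ.+ (+ 0 ℤ.* n ℤ.+ + 0 ℤ.* m)
          eq = solve-∀
  end-≡ m n ((δ , ε) ∷ σ) u = trans (end-≡ m n σ _)
    (trans (cong (ℤ._+ drift m n σ)
             (trans (partner-≡ ε m _) (cong (ℤ._+ sign ε ℤ.* m) (partner-≡ δ n u))))
           (eq (sign δ) (sign ε) (net proj₁ σ) (net proj₂ σ) m n u))
    where
    eq : ∀ d e a b m n u → u ℤ.+ d ℤ.* n ℤ.+ e ℤ.* m ℤ.+ (a ℤ.* n ℤ.+ b ℤ.* m) ≡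
                           u ℤ.+ ((d ℤ.+ a) ℤ.* n ℤ.+ (e ℤ.+ b) ℤ.* m)
    eq = solve-∀

Closed : ℕ → ℕ → Steps → Set
Closed m n σ = drift (+ m) (+ n) σ ≡ + 0

opaque
  end-closed : ∀ m n σ {u} → end (+ m) (+ n) σ u ≡ u → Closed m n σ
  end-closed m n σ {u} e = identityʳ-unique u _ (trans (sym (end-≡ (+ m) (+ n) σ u)) e)
    where open AbelianGroupProperties ℤₚ.+-0-abelianGroup

scaled : ℤ → ℕ → ℤ → ℤ
scaled x d z = x ℤ.+ z ℤ.* + d

opaque
  partner-scaled : ∀ s m d x z →
    partner s (+ (m ℕ.* d)) (scaled x d z) ≡ scaled x d (partner s (+ m) z)
  partner-scaled Sign.+ m d x z = trans (cong (ℤ._+ _) (ℤₚ.pos-* m d)) (eq (+ m) (+ d) x z)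
    where eq : ∀ m d x z → m ℤ.* d ℤ.+ (x ℤ.+ z ℤ.* d) ≡ x ℤ.+ (m ℤ.+ z) ℤ.* d
          eq = solve-∀
  partner-scaled Sign.- m d x z = trans
    (cong (λ e → scaled x d z ℤ.- e) (ℤₚ.pos-* m d)) (eq (+ m) (+ d) x z)
    where eq : ∀ m d x z → x ℤ.+ z ℤ.* d ℤ.- m ℤ.* d ≡ x ℤ.+ (z ℤ.- m) ℤ.* d
          eq = solve-∀

opaque
  base-scaled : ∀ s m d x z →
    base s (+ (m ℕ.* d)) (scaled x d z) ≡ scaled x d (base s (+ m) z)
  base-scaled Sign.+ m d x z = refl
  base-scaled Sign.- m d x z = partner-scaled Sign.- m d x z

opaque
  bases-scaled : ∀ m n d x σ z →
    bases (+ (m ℕ.* d)) (+ (n ℕ.* d)) σ (scaled x d z) ≡ map (scaled x d) (bases (+ m) (+ n) σ z)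
  bases-scaled m n d x []            z = refl
  bases-scaled m n d x ((δ , ε) ∷ σ) z
    rewrite partner-scaled δ n d x z
          | partner-scaled ε m d x (partner δ (+ n) z)
          | base-scaled ε m d x (partner δ (+ n) z)
    = cong (_ ∷_) (bases-scaled m n d x σ _)

opaque
  closed-unscale : ∀ m n d .{{_ : ℕ.NonZero d}} σ → Closed (m ℕ.* d) (n ℕ.* d) σ → Closed m n σ
  closed-unscale m n d@(suc _) σ c = ℤₚ.*-cancelʳ-≡ _ (+ 0) (+ d) (begin
    drift (+ m) (+ n) σ ℤ.* + d             ≡⟨ eq (net proj₁ σ) (net proj₂ σ) (+ m) (+ n) (+ d) ⟩
    drift (+ m ℤ.* + d) (+ n ℤ.* + d) σ     ≡⟨ cong₂ (λ p q → drift p q σ) (ℤₚ.pos-* m d) (ℤₚ.pos-* n d) ⟨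
    drift (+ (m ℕ.* d)) (+ (n ℕ.* d)) σ     ≡⟨ c ⟩
    + 0                                     ∎)
    where
    open ≡-Reasoning
    eq : ∀ a b m n d → (a ℤ.* n ℤ.+ b ℤ.* m) ℤ.* d ≡ a ℤ.* (n ℤ.* d) ℤ.+ b ℤ.* (m ℤ.* d)
    eq = solve-∀

-- Both nets of a cycle of odd length are odd, hence nonzero, which pins down m : n.
ratios : List (ℕ × ℕ)
ratios = (1 , 3) ∷ (1 , 5) ∷ (3 , 5) ∷ []

InRatio : ℕ → ℕ → Set
InRatio m n = ∃[ p ] ∃[ q ] ∃[ d ] ((p , q) ∈ ratios × m ≡ p ℕ.* d × n ≡ q ℕ.* d)

opaque
  -- From `m < n` follows `s < t`, which leaves three pairs. For `s = 1` the unit `d` is `m` itself;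
  -- `3 n = 5 m` makes 3 divide `m`, by coprimality with 5.
  ratio : ∀ {s t m n} → s ∈ 1 ∷ 3 ∷ 5 ∷ [] → t ∈ 1 ∷ 3 ∷ 5 ∷ [] → m < n → s ℕ.* n ≡ t ℕ.* m →
            InRatio m n
  ratio {s} {t} {m} {n} s∈ t∈ m<n eq = go s∈ t∈
    where
    absurd : s ≥ t → .{{ℕ.NonZero s}} → ∀ {X : Set} → X
    absurd t≤s = ⊥-elim (ℕₚ.<-irrefl (sym eq)
      (ℕₚ.≤-<-trans (ℕₚ.*-monoˡ-≤ m t≤s) (ℕₚ.*-monoʳ-< s m<n)))
    unit : ∀ {k l} → 1 ℕ.* k ≡ l → k ≡ l
    unit e = trans (sym (ℕₚ.*-identityˡ _)) e
    go : s ∈ 1 ∷ 3 ∷ 5 ∷ [] → t ∈ 1 ∷ 3 ∷ 5 ∷ [] → InRatio m n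
    go (here refl) (here refl) = absurd ℕₚ.≤-refl
    go (here refl) (there (here refl)) = 1 , 3 , m , here refl , sym (ℕₚ.*-identityˡ m) , unit eq
    go (here refl) (there (there (here refl))) =
      1 , 5 , m , there (here refl) , sym (ℕₚ.*-identityˡ m) , unit eq
    go (there (here refl)) (here refl) = absurd (from-yes (1 ℕₚ.≤? 3))
    go (there (here refl)) (there (here refl)) = absurd ℕₚ.≤-refl
    go (there (here refl)) (there (there (here refl)))
      with divides d refl ← coprime-divisor {3} {5} {m} (from-yes (coprime? 3 5))
        (divides n (trans (sym eq) (ℕₚ.*-comm 3 n)))
      = 3 , 5 , d , there (there (here refl)) , ℕₚ.*-comm d 3 ,
        ℕₚ.*-cancelˡ-≡ n (5 ℕ.* d) 3 (trans eq (trans (cong (5 ℕ.*_) (ℕₚ.*-comm d 3))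
          (trans (sym (ℕₚ.*-assoc 5 3 d)) (ℕₚ.*-assoc 3 5 d))))
    go (there (there (here refl))) (here refl) = absurd (from-yes (1 ℕₚ.≤? 5))
    go (there (there (here refl))) (there (here refl)) = absurd (from-yes (3 ℕₚ.≤? 5))
    go (there (there (here refl))) (there (there (here refl))) = absurd ℕₚ.≤-refl

opaque
  closed-abs : ∀ m n σ → Closed m n σ → ∣ net proj₁ σ ∣ ℕ.* n ≡ ∣ net proj₂ σ ∣ ℕ.* m
  closed-abs m n σ c = begin
    ∣ net proj₁ σ ∣ ℕ.* n        ≡⟨ ℤₚ.abs-* (net proj₁ σ) (+ n) ⟨
    ∣ net proj₁ σ ℤ.* + n ∣      ≡⟨ cong ∣_∣ (inverseˡ-unique (net proj₁ σ ℤ.* + n) _ c) ⟩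
    ∣ - (net proj₂ σ ℤ.* + m) ∣  ≡⟨ ℤₚ.∣-i∣≡∣i∣ (net proj₂ σ ℤ.* + m) ⟩
    ∣ net proj₂ σ ℤ.* + m ∣      ≡⟨ ℤₚ.abs-* (net proj₂ σ) (+ m) ⟩
    ∣ net proj₂ σ ∣ ℕ.* m        ∎
    where
    open ≡-Reasoning
    open AbelianGroupProperties ℤₚ.+-0-abelianGroup

-- Enumeration of step signs

signPairs : List (Sign × Sign)
signPairs = (Sign.+ , Sign.+) ∷ (Sign.+ , Sign.-) ∷ (Sign.- , Sign.+) ∷ (Sign.- , Sign.-) ∷ []

steps∈ : ∀ σ → σ ∈ tuples signPairs (length σ)
steps∈ σ = ∈-tuples (all∈ σ)
  where
  pair∈ : ∀ s → s ∈ signPairs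
  pair∈ (Sign.+ , Sign.+) = here refl
  pair∈ (Sign.+ , Sign.-) = there (here refl)
  pair∈ (Sign.- , Sign.+) = there (there (here refl))
  pair∈ (Sign.- , Sign.-) = there (there (there (here refl)))
  all∈ : ∀ σ → All (_∈ signPairs) σ
  all∈ []      = []
  all∈ (s ∷ σ) = pair∈ s ∷ all∈ σ

OddNets : Steps → Set
OddNets σ = ∣ net proj₁ σ ∣ ∈ 1 ∷ 3 ∷ 5 ∷ [] × ∣ net proj₂ σ ∣ ∈ 1 ∷ 3 ∷ 5 ∷ []

opaque
  -- A sum of an odd number of signs is odd and bounded by their number. This is checked on all 4 +
  -- 64 + 1024 step lists instead of by induction.
  oddNets : ∀ σ → length σ ∈ 1 ∷ 3 ∷ 5 ∷ [] → OddNets σ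
  oddNets σ |σ|∈ = lookup (lookup table |σ|∈) (steps∈ σ)
    where
    odds : List ℕ
    odds = 1 ∷ 3 ∷ 5 ∷ []
    oddNets? : ∀ σ → Dec (OddNets σ)
    oddNets? σ = any? (∣ net proj₁ σ ∣ ℕₚ.≟_) odds ×-dec any? (∣ net proj₂ σ ∣ ℕₚ.≟_) odds
    table : All (λ ℓ → All OddNets (tuples signPairs ℓ)) odds
    table = from-yes (all? (λ ℓ → all? oddNets? (tuples signPairs ℓ)) odds)

-- Exponents of the pieces of B, in units of d

triad dyad pentad gapped : List ℤ
triad  = + 0 ∷ + 2 ∷ + 4 ∷ []
dyad   = + 0 ∷ + 3 ∷ []
pentad   = + 0 ∷ + 2 ∷ + 4 ∷ + 6 ∷ + 8 ∷ []
-- With `m = 1` this gives 0, 1, 4, 5, 6, 7, 8, 9, 12, 13, which is also paired at distance 5: 0-5,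
-- 1-6, 4-9, 7-12, 8-13.
gapped = + 0 ∷ + 4 ∷ + 6 ∷ + 8 ∷ + 12 ∷ []

-- Fixing the start at 0 and the ratio in lowest terms makes this a finite check; `bases-origin` and
-- `rescale` carry it to an arbitrary start and unit.
Table : ℕ → (ℕ × ℕ → List ℤ → Set) → Set
Table ℓ Shape = ∀ {p q} → (p , q) ∈ ratios → ∀ σ → length σ ≡ ℓ → Closed p q σ →
  Shape (p , q) (bases (+ p) (+ q) σ (+ 0))

Entry : (ℕ × ℕ → List ℤ → Set) → ℕ × ℕ → Steps → Set
Entry Shape (p , q) σ = Closed p q σ → Shape (p , q) (bases (+ p) (+ q) σ (+ 0))

entries? : ∀ ℓ {Shape} → (∀ r bs → Dec (Shape r bs)) →
           Dec (All (λ r → All (Entry Shape r) (tuples signPairs ℓ)) ratios)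
entries? ℓ shape? = all? (λ r → all? (λ σ →
  (_ ℤₚ.≟ _) →-dec shape? r _) (tuples signPairs ℓ)) ratios

tabulated : ∀ {ℓ} Shape → All (λ r → All (Entry Shape r) (tuples signPairs ℓ)) ratios → Table ℓ Shape
tabulated _ entries r∈ σ refl = lookup (lookup entries r∈) (steps∈ σ)

_≟ᵣ_ : DecidableEquality (ℕ × ℕ)
_≟ᵣ_ = ≡-dec ℕₚ._≟_ ℕₚ._≟_

infix 4 _↭?_
_↭?_ : (xs ys : List ℤ) → Dec (xs ↭ₚ ys)
_↭?_ = permutation? ℤₚ._≟_

-- Two double steps can close up with both nets zero, whatever `m` and `n` are, so `Shape₂` takes
-- the ratio as a premise, to be supplied by the accompanying cycle of length 3. `Shape₃` and
-- `Shape₅` deliver it. Offsets are sought in `bs` because every pattern contains `+ 0`; this keeps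
-- the search finite.
Shape₁ Shape₂ Shape₃ Shape₅ : ℕ × ℕ → List ℤ → Set
Shape₁ r bs = ⊥
Shape₂ r bs = r ≡ (1 , 3) → Any (λ x → bs ↭ₚ map (ℤ._+_ x) dyad) bs
Shape₃ r bs = r ≡ (1 , 3) × Any (λ x → bs ↭ₚ map (ℤ._+_ x) triad) bs
Shape₅ r bs =
    r ≡ (1 , 3) × Any (λ x → Any (λ y → bs ↭ₚ map (ℤ._+_ x) triad ++ map (ℤ._+_ y) dyad) bs) bs
  ⊎ r ≡ (1 , 5) × Any (λ x → bs ↭ₚ map (ℤ._+_ x) pentad ⊎ bs ↭ₚ map (ℤ._+_ x) gapped) bs
  ⊎ r ≡ (3 , 5) × Any (λ x → bs ↭ₚ map (ℤ._+_ x) pentad) bs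

opaque
  table₁ : Table 1 Shape₁
  table₁ = tabulated Shape₁ (from-yes (entries? 1 λ _ _ → no λ ()))

  table₂ : Table 2 Shape₂
  table₂ = tabulated Shape₂ (from-yes (entries? 2 λ r bs →
    (r ≟ᵣ (1 , 3)) →-dec any? (λ x → bs ↭? map (ℤ._+_ x) dyad) bs))

  table₃ : Table 3 Shape₃
  table₃ = tabulated Shape₃ (from-yes (entries? 3 λ r bs →
    (r ≟ᵣ (1 , 3)) ×-dec any? (λ x → bs ↭? map (ℤ._+_ x) triad) bs))

  table₅ : Table 5 Shape₅
  table₅ = tabulated Shape₅ (from-yes (entries? 5 λ r bs →
          ((r ≟ᵣ (1 , 3)) ×-dec any? (λ x → any? (λ y →
            bs ↭? map (ℤ._+_ x) triad ++ map (ℤ._+_ y) dyad) bs) bs)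
    ⊎-dec ((r ≟ᵣ (1 , 5)) ×-dec any? (λ x →
            (bs ↭? map (ℤ._+_ x) pentad) ⊎-dec (bs ↭? map (ℤ._+_ x) gapped)) bs)
    ⊎-dec ((r ≟ᵣ (3 , 5)) ×-dec any? (λ x → bs ↭? map (ℤ._+_ x) pentad) bs)))

-- The cofactor of a polynomial with two binomial factors

opaque
  bases-origin : ∀ m n d σ u →
    bases (+ (m ℕ.* d)) (+ (n ℕ.* d)) σ u ≡ map (scaled u d) (bases (+ m) (+ n) σ (+ 0))
  bases-origin m n d σ u = trans
    (cong (bases _ _ σ) (origin u (+ d)))
    (bases-scaled m n d u σ (+ 0))
    where origin : ∀ u d → u ≡ u ℤ.+ + 0 ℤ.* d
          origin = solve-∀

opaque
  rescale : ∀ u d x {bs} O → bs ↭ₚ map (ℤ._+_ x) O →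
            map (scaled u d) bs ↭ₚ map (scaled (scaled u d x) d) O
  rescale u d x O p = ↭-trans (Perm.map⁺ (scaled u d) p)
    (↭-reflexive (trans (sym (Listₚ.map-∘ O)) (Listₚ.map-cong (λ z → eq u (+ d) x z) O)))
    where eq : ∀ u d x z → u ℤ.+ (x ℤ.+ z) ℤ.* d ≡ u ℤ.+ x ℤ.* d ℤ.+ z ℤ.* d
          eq = solve-∀

-- `m` and `B` already determine `P`. The three alternatives lead to the two-parameter families, to
-- `Q₁` or `Q₂`, and to `Q₃`.
CofactorAt : ℕ → ℕ → List ℤ → Set
CofactorAt d m B =
    m ≡ 1 ℕ.* d × ∃[ x ] ∃[ y ] B ↭ₚ map (scaled x d) triad ++ map (scaled y d) dyad
  ⊎ m ≡ 1 ℕ.* d × ∃[ x ] (B ↭ₚ map (scaled x d) pentad ⊎ B ↭ₚ map (scaled x d) gapped)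
  ⊎ m ≡ 3 ℕ.* d × ∃[ x ] B ↭ₚ map (scaled x d) pentad

Cofactor : ℕ → List ℤ → Set
Cofactor m B = ∃[ d ] (d ≥ 1 × CofactorAt d m B)

record Cycle (m n : ℕ) (B : List ℤ) : Set where
  constructor mkCycle
  field
    start      : ℤ
    steps      : Steps
    rest rest′ : List ℤ
    closed     : Closed m n steps
    splits     : B ↭ₚ bases (+ m) (+ n) steps start ++ rest
    balanced   : pairs (ℤ._+_ (+ m)) rest ↭ₚ pairs (ℤ._+_ (+ n)) rest′
    lengths    : length steps ℕ.+ length rest ≡ length B
    nonempty   : 1 ℕ.≤ length steps

opaque
  findCycle : ∀ m n b B B′ → pairs (ℤ._+_ (+ m)) (b ∷ B) ↭ₚ pairs (ℤ._+_ (+ n)) B′ →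
              Cycle m n (b ∷ B)
  findCycle m n b B B′ bal with cycle (+ m) (+ n) b B B′ bal
  ... | mkWalk [] _ _ _ _ _ , σ≢[] = ⊥-elim (σ≢[] refl)
  ... | mkWalk σ@(_ ∷ _) rest rest′ ends splits balanced , _ =
    mkCycle b σ rest rest′ (end-closed m n σ ends) splits balanced lengths (s≤s z≤n)
    where
    lengths : length σ ℕ.+ length rest ≡ suc (length B)
    lengths = sym (trans (Perm.↭-length splits) (trans
      (Listₚ.length-++ (bases (+ m) (+ n) σ b))
      (cong (ℕ._+ length rest) (length-bases (+ m) (+ n) σ b))))

OddCycle : ℕ → ℕ → (ℕ × ℕ → List ℤ → Set) → Steps → Set
OddCycle m n Shape σ = ∃[ p ] ∃[ q ] ∃[ d ]
  (d ≥ 1 × m ≡ p ℕ.* d × n ≡ q ℕ.* d × Shape (p , q) (bases (+ p) (+ q) σ (+ 0)))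

opaque
  -- Odd length makes both nets nonzero, hence gives the ratio and a unit `d`; measured in that
  -- unit, the walk is an entry of the table.
  oddCycle : ∀ {m n ℓ} Shape → m < n → ℓ ∈ 1 ∷ 3 ∷ 5 ∷ [] → Table ℓ Shape →
             ∀ σ → length σ ≡ ℓ → Closed m n σ → OddCycle m n Shape σ
  oddCycle {m} {n} _ m<n ℓ∈ table σ refl c
    with s∈ , t∈ ← oddNets σ ℓ∈
    with p , q , d , r∈ , refl , refl ← ratio s∈ t∈ m<n (closed-abs m n σ c)
    with d
  -- `d = 0` would give `m = n = 0`.
  ... | zero  = ⊥-elim (ℕₚ.n≮0 (subst (p ℕ.* 0 <_) (ℕₚ.*-zeroʳ q) m<n))
  ... | suc e = p , q , suc e , s≤s z≤n , refl , refl ,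
    table r∈ σ refl (closed-unscale p q (suc e) σ c)

opaque
  no-short-cycle : ∀ {m n} → m < n → ∀ σ → length σ ≡ 1 → Closed m n σ → ⊥
  no-short-cycle m<n σ |σ|≡1 c
    with _ , _ , _ , _ , _ , _ , () ← oddCycle Shape₁ m<n (here refl) table₁ σ |σ|≡1 c

-- Cycle types of at most five elements

emptyRest : ∀ {A : Set} {B bs rest : List A} → length rest ≡ 0 → B ↭ₚ bs ++ rest → B ↭ₚ bs
emptyRest {rest = []} _ p = ↭-trans p (Perm.++-identityʳ _)

opaque
  -- A lone element would be a cycle of length 1. This excludes the splittings 4 + 1 of five
  -- elements and 2 + 1 of three.
  no-singleton : ∀ {m n} → m < n → ∀ B B′ → length B ≡ 1 →
                 pairs (ℤ._+_ (+ m)) B ↭ₚ pairs (ℤ._+_ (+ n)) B′ → ⊥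
  no-singleton m<n (b ∷ []) B′ _ bal
    with mkCycle _ σ@(_ ∷ []) _ _ c _ _ _ _ ← findCycle _ _ b [] B′ bal
    = no-short-cycle m<n σ refl c

Triad Dyad : ℕ → List ℤ → Set
Triad d B = ∃[ x ] B ↭ₚ map (scaled x d) triad
Dyad  d B = ∃[ x ] B ↭ₚ map (scaled x d) dyad

opaque
  triadCycle : ∀ {m n u} → m < n → ∀ σ → length σ ≡ 3 → Closed m n σ →
               ∃[ d ] (d ≥ 1 × m ≡ 1 ℕ.* d × n ≡ 3 ℕ.* d × Triad d (bases (+ m) (+ n) σ u))
  triadCycle {u = u} m<n σ |σ|≡3 c
    with p , q , d , d≥1 , refl , refl , refl , any ←
      oddCycle Shape₃ m<n (there (here refl)) table₃ σ |σ|≡3 c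
    with x , p ← Any.satisfied any
    = d , d≥1 , refl , refl , scaled u d x ,
      ↭-trans (↭-reflexive (bases-origin 1 3 d σ u)) (rescale u d x triad p)

opaque
  dyadCycle : ∀ d {u} → d ≥ 1 → ∀ σ → length σ ≡ 2 → Closed (1 ℕ.* d) (3 ℕ.* d) σ →
              Dyad d (bases (+ (1 ℕ.* d)) (+ (3 ℕ.* d)) σ u)
  dyadCycle d@(suc _) {u} _ σ |σ|≡2 c
    with x , p ← Any.satisfied (table₂ (here refl) σ |σ|≡2 (closed-unscale 1 3 d σ c) refl)
    = scaled u d x , ↭-trans (↭-reflexive (bases-origin 1 3 d σ u)) (rescale u d x dyad p)

opaque
  triadRest : ∀ {m n} → m < n → ∀ B B′ → length B ≡ 3 →
              pairs (ℤ._+_ (+ m)) B ↭ₚ pairs (ℤ._+_ (+ n)) B′ →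
              ∃[ d ] (d ≥ 1 × m ≡ 1 ℕ.* d × n ≡ 3 ℕ.* d × Triad d B)
  triadRest m<n (b ∷ B) B′ |B|≡3 bal with findCycle _ _ b B B′ bal
  ... | mkCycle u σ@(_ ∷ []) rest rest′ c s bal′ l _ = ⊥-elim (no-short-cycle m<n σ refl c)
  ... | mkCycle u σ@(_ ∷ _ ∷ []) rest rest′ c s bal′ l _ =
    ⊥-elim (no-singleton m<n rest rest′ (ℕₚ.+-cancelˡ-≡ 2 _ _ (trans l |B|≡3)) bal′)
  ... | mkCycle u σ@(_ ∷ _ ∷ _ ∷ []) rest rest′ c s bal′ l _
    with d , d≥1 , m≡ , n≡ , x , t ← triadCycle {u = u} m<n σ refl c
    = d , d≥1 , m≡ , n≡ , x , ↭-trans (emptyRest (ℕₚ.+-cancelˡ-≡ 3 _ _ (trans l |B|≡3)) s) t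
  ... | mkCycle u (_ ∷ _ ∷ _ ∷ _ ∷ _) rest rest′ c s bal′ l _ with () ← trans l |B|≡3

opaque
  dyadRest : ∀ d → d ≥ 1 → ∀ B B′ → length B ≡ 2 → 1 ℕ.* d < 3 ℕ.* d →
             pairs (ℤ._+_ (+ (1 ℕ.* d))) B ↭ₚ pairs (ℤ._+_ (+ (3 ℕ.* d))) B′ → Dyad d B
  dyadRest d d≥1 (b ∷ B) B′ |B|≡2 m<n bal with findCycle _ _ b B B′ bal
  ... | mkCycle u σ@(_ ∷ []) rest rest′ c s bal′ l _ = ⊥-elim (no-short-cycle m<n σ refl c)
  ... | mkCycle u σ@(_ ∷ _ ∷ []) rest rest′ c s bal′ l _
    with x , t ← dyadCycle d {u} d≥1 σ refl c
    = x , ↭-trans (emptyRest (ℕₚ.+-cancelˡ-≡ 2 _ _ (trans l |B|≡2)) s) t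
  ... | mkCycle u (_ ∷ _ ∷ _ ∷ _) rest rest′ c s bal′ l _ with () ← trans l |B|≡2

opaque
  quintCycle : ∀ {m n u B} → m < n → ∀ σ → length σ ≡ 5 → Closed m n σ →
               B ↭ₚ bases (+ m) (+ n) σ u → Cofactor m B
  quintCycle {u = u} {B} m<n σ |σ|≡5 c whole
    with p , q , d , d≥1 , refl , refl , shape ←
      oddCycle Shape₅ m<n (there (there (here refl))) table₅ σ |σ|≡5 c
    = d , d≥1 , fromShape shape
    where
    whole′ : B ↭ₚ map (scaled u d) (bases (+ p) (+ q) σ (+ 0))
    whole′ = ↭-trans whole (↭-reflexive (bases-origin p q d σ u))
    at : ∀ x O → bases (+ p) (+ q) σ (+ 0) ↭ₚ map (ℤ._+_ x) O →
         B ↭ₚ map (scaled (scaled u d x) d) O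
    at x O t = ↭-trans whole′ (rescale u d x O t)
    fromShape : Shape₅ (p , q) (bases (+ p) (+ q) σ (+ 0)) → CofactorAt d (p ℕ.* d) B
    fromShape (inj₁ (refl , any))
      with x , any′ ← Any.satisfied any
      with y , t ← Any.satisfied any′
      = inj₁ (refl , scaled u d x , scaled u d y ,
        ↭-trans whole′ (↭-trans (Perm.map⁺ (scaled u d) t)
          (↭-trans (↭-reflexive
              (Listₚ.map-++ (scaled u d) (map (ℤ._+_ x) triad) (map (ℤ._+_ y) dyad)))
                   (Perm.++⁺ (rescale u d x triad ↭-refl) (rescale u d y dyad ↭-refl)))))
    fromShape (inj₂ (inj₁ (refl , any))) with Any.satisfied any
    ... | x , inj₁ t = inj₂ (inj₁ (refl , scaled u d x , inj₁ (at x pentad t)))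
    ... | x , inj₂ t = inj₂ (inj₁ (refl , scaled u d x , inj₂ (at x gapped t)))
    fromShape (inj₂ (inj₂ (refl , any)))
      with x , t ← Any.satisfied any
      = inj₂ (inj₂ (refl , scaled u d x , at x pentad t))

opaque
  -- The first cycle found has length 5, 3 or 2: length 1 is impossible, and length 4 strands a
  -- single element.
  cofactor : ∀ {m n} → m < n → ∀ B B′ → length B ≡ 5 →
             pairs (ℤ._+_ (+ m)) B ↭ₚ pairs (ℤ._+_ (+ n)) B′ → Cofactor m B
  cofactor {m} {n} m<n (b ∷ B) B′ |B|≡5 bal with findCycle m n b B B′ bal
  ... | mkCycle u σ@(_ ∷ []) rest rest′ c s bal′ l _ = ⊥-elim (no-short-cycle m<n σ refl c)
  ... | mkCycle u σ@(_ ∷ _ ∷ []) rest rest′ c s bal′ l _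
    -- The cycle of length 2 leaves the ratio open. The other three elements settle it, after which
    -- `dyadCycle` applies.
    with d , d≥1 , refl , refl , x , t ← triadRest m<n rest rest′ (ℕₚ.+-cancelˡ-≡ 2 _ _ (trans l |B|≡5)) bal′
    with y , t′ ← dyadCycle d {u} d≥1 σ refl c
    = d , d≥1 , inj₁ (refl , x , y ,
      ↭-trans s (↭-trans (Perm.++⁺ t′ t) (Perm.++-comm (map (scaled y d) dyad) _)))
  ... | mkCycle u σ@(_ ∷ _ ∷ _ ∷ []) rest rest′ c s bal′ l _
    with d , d≥1 , refl , refl , x , t ← triadCycle {u = u} m<n σ refl c
    with y , t′ ← dyadRest d d≥1 rest rest′ (ℕₚ.+-cancelˡ-≡ 3 _ _ (trans l |B|≡5)) m<n bal′
    = d , d≥1 , inj₁ (refl , x , y , ↭-trans s (Perm.++⁺ t t′))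
  ... | mkCycle u (_ ∷ _ ∷ _ ∷ _ ∷ []) rest rest′ c s bal′ l _ =
    ⊥-elim (no-singleton m<n rest rest′ (ℕₚ.+-cancelˡ-≡ 4 _ _ (trans l |B|≡5)) bal′)
  ... | mkCycle u σ@(_ ∷ _ ∷ _ ∷ _ ∷ _ ∷ []) rest rest′ c s bal′ l _ =
    quintCycle m<n σ refl c (emptyRest (ℕₚ.+-cancelˡ-≡ 5 _ _ (trans l |B|≡5)) s)
  ... | mkCycle u (_ ∷ _ ∷ _ ∷ _ ∷ _ ∷ _ ∷ _) rest rest′ c s bal′ l _ with () ← trans l |B|≡5

-- The semiring N₁

open Setoid N₁-setoid
  using () renaming (refl to ≈-refl; sym to ≈-sym; trans to ≈-trans; reflexive to ≈-reflexive)
module ≈-Reasoning = SetoidReasoning N₁-setoid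

∷-cong : ∀ {a b p q} → a ≡ b → p ≈ q → a ∷ p ≈ b ∷ q
∷-cong a≡b p≈q = mk≈ λ { zero → a≡b ; (suc i) → coeff-≡ p≈q i }

tail : N₁ → N₁
tail []      = []
tail (_ ∷ p) = p

coeff-tail : ∀ p i → coeff (tail p) i ≡ coeff p (suc i)
coeff-tail []      i = refl
coeff-tail (_ ∷ _) i = refl

tail-cong : ∀ {p q} → p ≈ q → tail p ≈ tail q
tail-cong {p} {q} e = mk≈ λ i → trans (coeff-tail p i) (trans (coeff-≡ e (suc i)) (sym (coeff-tail q i)))

head∷tail : ∀ p → p ≈ coeff p 0 ∷ tail p
head∷tail []      = mk≈ λ { zero → refl ; (suc _) → refl }
head∷tail (_ ∷ _) = ≈-refl

0∷[] : 0 ∷ [] ≈ []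
0∷[] = ≈-sym (head∷tail [])

coeff-⊕ : ∀ p q i → coeff (p ⊕ q) i ≡ coeff p i ℕ.+ coeff q i
coeff-⊕ []      q       i       = refl
coeff-⊕ (a ∷ p) []      i       = sym (ℕₚ.+-identityʳ _)
coeff-⊕ (a ∷ p) (b ∷ q) zero    = refl
coeff-⊕ (a ∷ p) (b ∷ q) (suc i) = coeff-⊕ p q i

coeff-· : ∀ a p i → coeff (a · p) i ≡ a ℕ.* coeff p i
coeff-· a []      i       = sym (ℕₚ.*-zeroʳ a)
coeff-· a (b ∷ p) zero    = refl
coeff-· a (b ∷ p) (suc i) = coeff-· a p i

⊕-cong : ∀ {p p′ q q′} → p ≈ p′ → q ≈ q′ → p ⊕ q ≈ p′ ⊕ q′
⊕-cong {p} {p′} {q} {q′} e f = mk≈ λ i → trans (coeff-⊕ p q i)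
  (trans (cong₂ ℕ._+_ (coeff-≡ e i) (coeff-≡ f i)) (sym (coeff-⊕ p′ q′ i)))

⊕-comm : ∀ p q → p ⊕ q ≈ q ⊕ p
⊕-comm p q = mk≈ λ i → trans (coeff-⊕ p q i)
  (trans (ℕₚ.+-comm (coeff p i) (coeff q i)) (sym (coeff-⊕ q p i)))

⊕-assoc : ∀ p q r → (p ⊕ q) ⊕ r ≈ p ⊕ (q ⊕ r)
⊕-assoc p q r = mk≈ λ i → begin
  coeff (p ⊕ q ⊕ r) i                      ≡⟨ coeff-⊕ (p ⊕ q) r i ⟩
  coeff (p ⊕ q) i ℕ.+ coeff r i            ≡⟨ cong (ℕ._+ coeff r i) (coeff-⊕ p q i) ⟩
  coeff p i ℕ.+ coeff q i ℕ.+ coeff r i    ≡⟨ ℕₚ.+-assoc (coeff p i) (coeff q i) (coeff r i) ⟩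
  coeff p i ℕ.+ (coeff q i ℕ.+ coeff r i)  ≡⟨ cong (coeff p i ℕ.+_) (coeff-⊕ q r i) ⟨
  coeff p i ℕ.+ coeff (q ⊕ r) i            ≡⟨ coeff-⊕ p (q ⊕ r) i ⟨
  coeff (p ⊕ (q ⊕ r)) i                    ∎
  where open ≡-Reasoning

⊕-identityʳ : ∀ p → p ⊕ [] ≈ p
⊕-identityʳ p = ⊕-comm p []

⊕-0-isCommutativeMonoid : IsCommutativeMonoid _≈_ _⊕_ 0#
⊕-0-isCommutativeMonoid = isCommutativeMonoidˡ record
  { isSemigroup = record
    { isMagma = record { isEquivalence = Setoid.isEquivalence N₁-setoid ; ∙-cong = ⊕-cong }
    ; assoc   = ⊕-assoc
    }
  ; identityˡ = λ _ → ≈-refl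
  ; comm      = ⊕-comm
  }

⊕-0-commutativeMonoid : CommutativeMonoid 0ℓ 0ℓ
⊕-0-commutativeMonoid = record { isCommutativeMonoid = ⊕-0-isCommutativeMonoid }

open CommutativeSemigroupProperties (CommutativeMonoid.commutativeSemigroup ⊕-0-commutativeMonoid)
  using () renaming (interchange to ⊕-interchange; x∙yz≈y∙xz to ⊕-leftSwap)

⊕-cancelˡ : ∀ p {q r} → p ⊕ q ≈ p ⊕ r → q ≈ r
⊕-cancelˡ p {q} {r} e = mk≈ λ i → ℕₚ.+-cancelˡ-≡ (coeff p i) _ _
  (trans (sym (coeff-⊕ p q i)) (trans (coeff-≡ e i) (coeff-⊕ p r i)))

·-congˡ : ∀ a {p q} → p ≈ q → a · p ≈ a · q
·-congˡ a {p} {q} e = mk≈ λ i →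
  trans (coeff-· a p i) (trans (cong (a ℕ.*_) (coeff-≡ e i)) (sym (coeff-· a q i)))

·-distribˡ : ∀ a p q → a · (p ⊕ q) ≈ a · p ⊕ a · q
·-distribˡ a p q = mk≈ λ i → begin
  coeff (a · (p ⊕ q)) i                  ≡⟨ coeff-· a (p ⊕ q) i ⟩
  a ℕ.* coeff (p ⊕ q) i                  ≡⟨ cong (a ℕ.*_) (coeff-⊕ p q i) ⟩
  a ℕ.* (coeff p i ℕ.+ coeff q i)        ≡⟨ ℕₚ.*-distribˡ-+ a (coeff p i) (coeff q i) ⟩
  a ℕ.* coeff p i ℕ.+ a ℕ.* coeff q i    ≡⟨ cong₂ ℕ._+_ (coeff-· a p i) (coeff-· a q i) ⟨
  coeff (a · p) i ℕ.+ coeff (a · q) i    ≡⟨ coeff-⊕ (a · p) (a · q) i ⟨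
  coeff (a · p ⊕ a · q) i                ∎
  where open ≡-Reasoning

·-assoc : ∀ a b p → (a ℕ.* b) · p ≈ a · (b · p)
·-assoc a b p = mk≈ λ i → begin
  coeff ((a ℕ.* b) · p) i    ≡⟨ coeff-· (a ℕ.* b) p i ⟩
  a ℕ.* b ℕ.* coeff p i      ≡⟨ ℕₚ.*-assoc a b _ ⟩
  a ℕ.* (b ℕ.* coeff p i)    ≡⟨ cong (a ℕ.*_) (coeff-· b p i) ⟨
  a ℕ.* coeff (b · p) i      ≡⟨ coeff-· a (b · p) i ⟨
  coeff (a · (b · p)) i      ∎
  where open ≡-Reasoning

1·-identity : ∀ p → 1 · p ≈ p
1·-identity p = mk≈ λ i → trans (coeff-· 1 p i) (ℕₚ.*-identityˡ _)

0·-zero : ∀ p → 0 · p ≈ 0#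
0·-zero p = mk≈ (coeff-· 0 p)

⊗-zeroʳ : ∀ p → p ⊗ [] ≈ []
⊗-zeroʳ []      = ≈-refl
⊗-zeroʳ (a ∷ p) = ≈-trans (∷-cong refl (⊗-zeroʳ p)) 0∷[]

⊗-congˡ : ∀ p {q r} → q ≈ r → p ⊗ q ≈ p ⊗ r
⊗-congˡ []      e = ≈-refl
⊗-congˡ (a ∷ p) e = ⊕-cong (·-congˡ a e) (∷-cong refl (⊗-congˡ p e))

-- The recursion of `_⊗_` read in its second argument; matched against the defining clause it gives
-- commutativity.
⊗-∷ : ∀ p b q → p ⊗ (b ∷ q) ≈ b · p ⊕ (0 ∷ p ⊗ q)
⊗-∷ []      b q = ≈-sym 0∷[]
⊗-∷ (a ∷ p) b q = ∷-cong (cong (ℕ._+ 0) (ℕₚ.*-comm a b))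
  (≈-trans (⊕-cong ≈-refl (⊗-∷ p b q)) (⊕-leftSwap (a · q) (b · p) (0 ∷ p ⊗ q)))

⊗-comm : ∀ p q → p ⊗ q ≈ q ⊗ p
⊗-comm []      q = ≈-sym (⊗-zeroʳ q)
⊗-comm (a ∷ p) q = ≈-trans (⊕-cong ≈-refl (∷-cong refl (⊗-comm p q))) (≈-sym (⊗-∷ q a p))

⊗-cong : ∀ {p p′ q q′} → p ≈ p′ → q ≈ q′ → p ⊗ q ≈ p′ ⊗ q′
⊗-cong {p} {p′} {q} {q′} e f = ≈-trans (⊗-congˡ p f)
  (≈-trans (⊗-comm p q′) (≈-trans (⊗-congˡ q′ e) (⊗-comm q′ p′)))

⊗-distribˡ : ∀ p q r → p ⊗ (q ⊕ r) ≈ p ⊗ q ⊕ p ⊗ r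
⊗-distribˡ []      q r = ≈-refl
⊗-distribˡ (a ∷ p) q r = ≈-trans
  (⊕-cong (·-distribˡ a q r) (∷-cong refl (⊗-distribˡ p q r)))
  (⊕-interchange (a · q) (a · r) (0 ∷ p ⊗ q) (0 ∷ p ⊗ r))

⊗-distribʳ : ∀ p q r → (q ⊕ r) ⊗ p ≈ q ⊗ p ⊕ r ⊗ p
⊗-distribʳ p q r = ≈-trans (⊗-comm (q ⊕ r) p)
  (≈-trans (⊗-distribˡ p q r) (⊕-cong (⊗-comm p q) (⊗-comm p r)))

·-⊗ : ∀ a p q → (a · p) ⊗ q ≈ a · (p ⊗ q)
·-⊗ a []      q = ≈-refl
·-⊗ a (b ∷ p) q = ≈-trans
  (⊕-cong (·-assoc a b q) (∷-cong (sym (ℕₚ.*-zeroʳ a)) (·-⊗ a p q)))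
  (≈-sym (·-distribˡ a (b · q) (0 ∷ p ⊗ q)))

0∷-⊗ : ∀ p q → (0 ∷ p) ⊗ q ≈ 0 ∷ p ⊗ q
0∷-⊗ p q = ⊕-cong (0·-zero q) ≈-refl

⊗-assoc : ∀ p q r → (p ⊗ q) ⊗ r ≈ p ⊗ (q ⊗ r)
⊗-assoc []      q r = ≈-refl
⊗-assoc (a ∷ p) q r = ≈-trans (⊗-distribʳ r (a · q) (0 ∷ p ⊗ q))
  (⊕-cong (·-⊗ a q r) (≈-trans (0∷-⊗ (p ⊗ q) r) (∷-cong refl (⊗-assoc p q r))))

⊗-identityˡ : ∀ p → 1# ⊗ p ≈ p
⊗-identityˡ p = ≈-trans (⊕-cong (1·-identity p) 0∷[]) (⊕-identityʳ p)

⊗-identityʳ : ∀ p → p ⊗ 1# ≈ p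
⊗-identityʳ p = ≈-trans (⊗-comm p 1#) (⊗-identityˡ p)

⊗-1-isCommutativeMonoid : IsCommutativeMonoid _≈_ _⊗_ 1#
⊗-1-isCommutativeMonoid = isCommutativeMonoidˡ record
  { isSemigroup = record
    { isMagma = record { isEquivalence = Setoid.isEquivalence N₁-setoid ; ∙-cong = ⊗-cong }
    ; assoc   = ⊗-assoc
    }
  ; identityˡ = ⊗-identityˡ
  ; comm      = ⊗-comm
  }

⊗-1-commutativeMonoid : CommutativeMonoid 0ℓ 0ℓ
⊗-1-commutativeMonoid = record { isCommutativeMonoid = ⊗-1-isCommutativeMonoid }

open CommutativeSemigroupProperties (CommutativeMonoid.commutativeSemigroup ⊗-1-commutativeMonoid)
  using () renaming (x∙yz≈y∙xz to ⊗-leftSwap)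

X^-⊗ : ∀ m n → X^ m ⊗ X^ n ≈ X^ (m ℕ.+ n)
X^-⊗ zero    n = ⊗-identityˡ (X^ n)
X^-⊗ (suc m) n = ≈-trans (0∷-⊗ (X^ m) (X^ n)) (∷-cong refl (X^-⊗ m n))

coeff-⊗-0 : ∀ p q → coeff (p ⊗ q) 0 ≡ coeff p 0 ℕ.* coeff q 0
coeff-⊗-0 []      q = refl
coeff-⊗-0 (a ∷ p) q = trans (coeff-⊕ (a · q) (0 ∷ p ⊗ q) 0)
  (trans (ℕₚ.+-identityʳ _) (coeff-· a q 0))

-- Coefficients are compared from the constant term upwards. The heads agree after division by
-- `coeff p 0`; cancelling the common summand `coeff q 0 · p` leaves the same equation for the
-- tails.
⊗-cancelˡ : ∀ p → coeff p 0 ≢ 0 → ∀ {q r} → p ⊗ q ≈ p ⊗ r → q ≈ r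
⊗-cancelˡ p p₀≢0 {q} {r} e = mk≈ λ i → go i q r e
  where
  peel : ∀ q → p ⊗ q ≈ coeff q 0 · p ⊕ (0 ∷ p ⊗ tail q)
  peel q = ≈-trans (⊗-congˡ p (head∷tail q)) (⊗-∷ p _ (tail q))
  head≡ : ∀ q r → p ⊗ q ≈ p ⊗ r → coeff q 0 ≡ coeff r 0
  head≡ q r e = ℕₚ.*-cancelˡ-≡ _ _ (coeff p 0) {{ℕ.≢-nonZero p₀≢0}}
    (trans (sym (coeff-⊗-0 p q)) (trans (coeff-≡ e 0) (coeff-⊗-0 p r)))
  go : ∀ i q r → p ⊗ q ≈ p ⊗ r → coeff q i ≡ coeff r i
  go zero    q r e = head≡ q r e
  go (suc i) q r e = trans (sym (coeff-tail q i)) (trans (go i (tail q) (tail r) tails) (coeff-tail r i))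
    where
    tails : p ⊗ tail q ≈ p ⊗ tail r
    tails = tail-cong (⊕-cancelˡ (coeff q 0 · p) (≈-trans (≈-sym (peel q)) (≈-trans e
      (≈-trans (peel r) (≈-reflexive (cong (λ a → a · p ⊕ (0 ∷ p ⊗ tail r)) (sym (head≡ q r e))))))))

-- Values at 1

value : N₁ → ℕ
value p = eval p 1

value-∷ : ∀ a p → value (a ∷ p) ≡ a ℕ.+ value p
value-∷ a p = cong (a ℕ.+_) (ℕₚ.*-identityˡ _)

value≡0 : ∀ p → p ≈ [] → value p ≡ 0
value≡0 []      e = refl
value≡0 (a ∷ p) e = trans (value-∷ a p) (cong₂ ℕ._+_ (coeff-≡ e 0) (value≡0 p (tail-cong e)))

value≡0⇒≈0 : ∀ p → value p ≡ 0 → p ≈ []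
value≡0⇒≈0 []      _ = ≈-refl
value≡0⇒≈0 (a ∷ p) e = ≈-trans
  (∷-cong (ℕₚ.m+n≡0⇒m≡0 a e′) (value≡0⇒≈0 p (ℕₚ.m+n≡0⇒n≡0 a e′))) 0∷[]
  where e′ = trans (sym (value-∷ a p)) e

value-cong : ∀ p q → p ≈ q → value p ≡ value q
value-cong []      q       e = sym (value≡0 q (≈-sym e))
value-cong (a ∷ p) []      e = value≡0 (a ∷ p) e
value-cong (a ∷ p) (b ∷ q) e =
  cong₂ (λ a v → a ℕ.+ 1 ℕ.* v) (coeff-≡ e 0) (value-cong p q (tail-cong e))

value-⊕ : ∀ p q → value (p ⊕ q) ≡ value p ℕ.+ value q
value-⊕ []      q       = refl
value-⊕ (a ∷ p) []      = sym (ℕₚ.+-identityʳ _)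
value-⊕ (a ∷ p) (b ∷ q) = begin
  value (a ℕ.+ b ∷ p ⊕ q)                        ≡⟨ value-∷ (a ℕ.+ b) (p ⊕ q) ⟩
  a ℕ.+ b ℕ.+ value (p ⊕ q)                      ≡⟨ cong (a ℕ.+ b ℕ.+_) (value-⊕ p q) ⟩
  a ℕ.+ b ℕ.+ (value p ℕ.+ value q)              ≡⟨ ℕ-interchange a b (value p) (value q) ⟩
  a ℕ.+ value p ℕ.+ (b ℕ.+ value q)              ≡⟨ cong₂ ℕ._+_ (value-∷ a p) (value-∷ b q) ⟨
  value (a ∷ p) ℕ.+ value (b ∷ q)                ∎
  where
  open ≡-Reasoning
  open CommutativeSemigroupProperties ℕₚ.+-commutativeSemigroup
    using () renaming (interchange to ℕ-interchange)

value-· : ∀ a p → value (a · p) ≡ a ℕ.* value p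
value-· a []      = sym (ℕₚ.*-zeroʳ a)
value-· a (b ∷ p) = begin
  value (a · (b ∷ p))              ≡⟨ value-∷ (a ℕ.* b) (a · p) ⟩
  a ℕ.* b ℕ.+ value (a · p)        ≡⟨ cong (a ℕ.* b ℕ.+_) (value-· a p) ⟩
  a ℕ.* b ℕ.+ a ℕ.* value p        ≡⟨ ℕₚ.*-distribˡ-+ a b (value p) ⟨
  a ℕ.* (b ℕ.+ value p)            ≡⟨ cong (a ℕ.*_) (value-∷ b p) ⟨
  a ℕ.* value (b ∷ p)              ∎
  where open ≡-Reasoning

value-⊗ : ∀ p q → value (p ⊗ q) ≡ value p ℕ.* value q
value-⊗ []      q = refl
value-⊗ (a ∷ p) q = begin
  value (a · q ⊕ (0 ∷ p ⊗ q))               ≡⟨ value-⊕ (a · q) (0 ∷ p ⊗ q) ⟩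
  value (a · q) ℕ.+ value (0 ∷ p ⊗ q)
    ≡⟨ cong₂ ℕ._+_ (value-· a q) (trans (value-∷ 0 (p ⊗ q)) (value-⊗ p q)) ⟩
  a ℕ.* value q ℕ.+ value p ℕ.* value q     ≡⟨ ℕₚ.*-distribʳ-+ (value q) a (value p) ⟨
  (a ℕ.+ value p) ℕ.* value q               ≡⟨ cong (ℕ._* value q) (value-∷ a p) ⟨
  value (a ∷ p) ℕ.* value q                 ∎
  where open ≡-Reasoning

-- Polynomials as multisets of exponents

mon : List ℕ → N₁
mon []      = 0#
mon (e ∷ E) = X^ e ⊕ mon E

exps : N₁ → List ℕ
exps []      = []
exps (a ∷ p) = replicate a 0 ++ map suc (exps p)

mon-++ : ∀ E F → mon (E ++ F) ≈ mon E ⊕ mon F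
mon-++ []      F = ≈-refl
mon-++ (e ∷ E) F = ≈-trans (⊕-cong ≈-refl (mon-++ E F)) (≈-sym (⊕-assoc (X^ e) (mon E) (mon F)))

mon-↭ : ∀ {E F} → E ↭ₚ F → mon E ≈ mon F
mon-↭ _↭ₚ_.refl                = ≈-refl
mon-↭ (prep e p)               = ⊕-cong ≈-refl (mon-↭ p)
mon-↭ (swap {E} {F} e f p)     = ≈-trans (⊕-leftSwap (X^ e) (X^ f) (mon E))
  (⊕-cong (≈-refl {X^ f}) (⊕-cong (≈-refl {X^ e}) (mon-↭ p)))
mon-↭ (_↭ₚ_.trans p q)         = ≈-trans (mon-↭ p) (mon-↭ q)

mon-map-suc : ∀ E → mon (map suc E) ≈ 0 ∷ mon E
mon-map-suc []      = ≈-sym 0∷[]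
mon-map-suc (e ∷ E) = ⊕-cong (≈-refl {0 ∷ X^ e}) (mon-map-suc E)

mon-replicate-0 : ∀ a → mon (replicate a 0) ≈ a ∷ []
mon-replicate-0 zero    = ≈-sym 0∷[]
mon-replicate-0 (suc a) = ⊕-cong (≈-refl {1#}) (mon-replicate-0 a)

mon-exps : ∀ p → p ≈ mon (exps p)
mon-exps []      = ≈-refl
mon-exps (a ∷ p) = ≈-sym (begin
  mon (replicate a 0 ++ map suc (exps p))        ≈⟨ mon-++ (replicate a 0) _ ⟩
  mon (replicate a 0) ⊕ mon (map suc (exps p))   ≈⟨ ⊕-cong (mon-replicate-0 a) (mon-map-suc (exps p)) ⟩
  (a ℕ.+ 0) ∷ mon (exps p)                       ≈⟨ ∷-cong (ℕₚ.+-identityʳ a) (≈-sym (mon-exps p)) ⟩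
  a ∷ p                                          ∎)
  where open ≈-Reasoning

length-exps : ∀ p → length (exps p) ≡ value p
length-exps []      = refl
length-exps (a ∷ p) = begin
  length (replicate a 0 ++ map suc (exps p))                ≡⟨ Listₚ.length-++ (replicate a 0) ⟩
  length (replicate a 0) ℕ.+ length (map suc (exps p))
    ≡⟨ cong₂ ℕ._+_ (Listₚ.length-replicate a) (trans (Listₚ.length-map suc (exps p)) (length-exps p)) ⟩
  a ℕ.+ value p                                             ≡⟨ value-∷ a p ⟨
  value (a ∷ p)                                             ∎
  where open ≡-Reasoning

coeff-X^ : ∀ e → coeff (X^ e) e ≡ 1
coeff-X^ zero    = refl
coeff-X^ (suc e) = coeff-X^ e

coeff-X^-≢ : ∀ {e i} → i ≢ e → coeff (X^ e) i ≡ 0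
coeff-X^-≢ {zero}  {zero}  i≢e = ⊥-elim (i≢e refl)
coeff-X^-≢ {zero}  {suc i} i≢e = refl
coeff-X^-≢ {suc e} {zero}  i≢e = refl
coeff-X^-≢ {suc e} {suc i} i≢e = coeff-X^-≢ λ i≡e → i≢e (cong suc i≡e)

coeff-mon-∈ : ∀ {e} E → coeff (mon E) e ≢ 0 → e ∈ E
coeff-mon-∈     []      c≢0 = ⊥-elim (c≢0 refl)
coeff-mon-∈ {e} (f ∷ E) c≢0 with e ℕₚ.≟ f
... | yes e≡f = here e≡f
... | no  e≢f = there (coeff-mon-∈ E λ c≡0 →
  c≢0 (trans (coeff-⊕ (X^ f) (mon E) e) (cong₂ ℕ._+_ (coeff-X^-≢ e≢f) c≡0)))

coeff-mon-head : ∀ e E → coeff (mon (e ∷ E)) e ≢ 0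
coeff-mon-head e E c≡0 with () ← trans (cong (ℕ._+ coeff (mon E) e) (sym (coeff-X^ e)))
  (trans (sym (coeff-⊕ (X^ e) (mon E) e)) c≡0)

-- The first exponent `e` of `E` has a nonzero coefficient in `mon F` as well, so it occurs in `F`
-- and `X^ e` can be cancelled.
mon-injective : ∀ E F → mon E ≈ mon F → E ↭ₚ F
mon-injective []      []      eq = ↭-refl
mon-injective []      (f ∷ F) eq = ⊥-elim (coeff-mon-head f F (sym (coeff-≡ eq f)))
mon-injective (e ∷ E) F       eq = ↭-trans
  (prep e (mon-injective E (F ─ e∈F) (⊕-cancelˡ (X^ e) (≈-trans eq (mon-↭ (remove-↭ e∈F))))))
  (↭-sym (remove-↭ e∈F))
  where
  e∈F : e ∈ F
  e∈F = coeff-mon-∈ F λ c≡0 → coeff-mon-head e E (trans (coeff-≡ eq e) c≡0)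

X^-mon : ∀ c E → X^ c ⊗ mon E ≈ mon (map (c ℕ.+_) E)
X^-mon zero    E = ≈-trans (⊗-identityˡ (mon E)) (≈-reflexive (cong mon (sym (Listₚ.map-id E))))
X^-mon (suc c) E = begin
  X^ (suc c) ⊗ mon E               ≈⟨ 0∷-⊗ (X^ c) (mon E) ⟩
  0 ∷ X^ c ⊗ mon E                 ≈⟨ ∷-cong refl (X^-mon c E) ⟩
  0 ∷ mon (map (c ℕ.+_) E)         ≈⟨ mon-map-suc (map (c ℕ.+_) E) ⟨
  mon (map suc (map (c ℕ.+_) E))   ≡⟨ cong mon (Listₚ.map-∘ E) ⟨
  mon (map (suc c ℕ.+_) E)         ∎
  where open ≈-Reasoning

-- The passage from algebra to combinatorics: a factor `1# ⊕ X^ m` is a matching of the exponents at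
-- distance `m`.
binomial-mon : ∀ m B → (1# ⊕ X^ m) ⊗ mon B ≈ mon (pairs (m ℕ.+_) B)
binomial-mon m []      = ⊗-zeroʳ (1# ⊕ X^ m)
binomial-mon m (b ∷ B) = begin
  (1# ⊕ X^ m) ⊗ (X^ b ⊕ mon B)                              ≈⟨ ⊗-distribˡ (1# ⊕ X^ m) (X^ b) (mon B) ⟩
  (1# ⊕ X^ m) ⊗ X^ b ⊕ (1# ⊕ X^ m) ⊗ mon B
    ≈⟨ ⊕-cong (⊗-distribʳ (X^ b) 1# (X^ m)) (binomial-mon m B) ⟩
  (1# ⊗ X^ b ⊕ X^ m ⊗ X^ b) ⊕ mon (pairs (m ℕ.+_) B)
    ≈⟨ ⊕-cong (⊕-cong (⊗-identityˡ (X^ b)) (X^-⊗ m b)) ≈-refl ⟩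
  (X^ b ⊕ X^ (m ℕ.+ b)) ⊕ mon (pairs (m ℕ.+_) B)            ≈⟨ ⊕-assoc (X^ b) (X^ (m ℕ.+ b)) _ ⟩
  mon (pairs (m ℕ.+_) (b ∷ B))                              ∎
  where open ≈-Reasoning

substitute-mon : ∀ d p → p ⟨ X^ d ⟩ ≈ mon (map (ℕ._* d) (exps p))
substitute-mon d []      = ≈-refl
substitute-mon d (a ∷ p) = begin
  (a ∷ []) ⊕ X^ d ⊗ p ⟨ X^ d ⟩
    ≈⟨ ⊕-cong (mon-replicate-0 a) (⊗-congˡ (X^ d) (≈-sym (substitute-mon d p))) ⟨
  mon (replicate a 0) ⊕ X^ d ⊗ mon (map (ℕ._* d) (exps p))
    ≈⟨ ⊕-cong ≈-refl (X^-mon d (map (ℕ._* d) (exps p))) ⟩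
  mon (replicate a 0) ⊕ mon (map (d ℕ.+_) (map (ℕ._* d) (exps p)))
    ≈⟨ mon-++ (replicate a 0) _ ⟨
  mon (replicate a 0 ++ map (d ℕ.+_) (map (ℕ._* d) (exps p)))
    -- Both composite maps are the same function, because `suc e * d` computes to `d + e * d`.
    ≡⟨ cong mon (cong₂ _++_ (sym (Listₚ.map-replicate (ℕ._* d) a 0))
         (trans (sym (Listₚ.map-∘ (exps p))) (Listₚ.map-∘ (exps p)))) ⟩
  mon (map (ℕ._* d) (replicate a 0) ++ map (ℕ._* d) (map suc (exps p)))
    ≡⟨ cong mon (Listₚ.map-++ (ℕ._* d) (replicate a 0) (map suc (exps p))) ⟨
  mon (map (ℕ._* d) (exps (a ∷ p)))                         ∎
  where open ≈-Reasoning

-- Irreducible factorisations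

module ↭ where
  open SetoidPermutation N₁-setoid public hiding (_↭_)
  open SetoidPermutationProperties N₁-setoid public

∏-↭ : ∀ {Qs Rs} → Qs ↭ Rs → ∏ Qs ≈ ∏ Rs
∏-↭ = ↭.foldr-commMonoid ⊗-1-isCommutativeMonoid

∏-++ : ∀ Qs Rs → ∏ (Qs ++ Rs) ≈ ∏ Qs ⊗ ∏ Rs
∏-++ []       Rs = ≈-sym (⊗-identityˡ (∏ Rs))
∏-++ (Q ∷ Qs) Rs = ≈-trans (⊗-congˡ Q (∏-++ Qs Rs)) (≈-sym (⊗-assoc Q (∏ Qs) (∏ Rs)))

∏-replicate-X : ∀ k → ∏ (replicate k (X^ 1)) ≈ X^ k
∏-replicate-X zero    = ≈-refl
∏-replicate-X (suc k) = ≈-trans (⊗-congˡ (X^ 1) (∏-replicate-X k)) (X^-⊗ 1 k)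

Proper : N₁ → Set
Proper Q = Irreducible Q × coeff Q 0 ≢ 0

-- With constant term 0, `Q` is `X^ 1 ⊗ tail Q`, and irreducibility makes `tail Q` equal to 1.
X-or-proper : ∀ {Q} → Irreducible Q → Q ≈ X^ 1 ⊎ Proper Q
X-or-proper {Q} irr@(_ , _ , split) with coeff Q 0 ℕₚ.≟ 0
... | no  Q₀≢0 = inj₂ (irr , Q₀≢0)
... | yes Q₀≡0 = inj₁ ([ (λ X≈1 → ⊥-elim (absurd (coeff-≡ X≈1 0)))
                       , (λ tail≈1 → ≈-trans Q≈0∷ (∷-cong refl tail≈1)) ]′
                       (split (X^ 1) (tail Q) Q≈X⊗))
  where
  absurd : 0 ≢ 1
  absurd ()
  Q≈0∷ : Q ≈ 0 ∷ tail Q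
  Q≈0∷ = ≈-trans (head∷tail Q) (∷-cong Q₀≡0 ≈-refl)
  Q≈X⊗ : Q ≈ X^ 1 ⊗ tail Q
  Q≈X⊗ = ≈-trans Q≈0∷ (≈-sym (≈-trans (0∷-⊗ 1# (tail Q)) (∷-cong refl (⊗-identityˡ (tail Q)))))

splitX : ∀ {Qs} → All Irreducible Qs →
         ∃[ k ] ∃[ Ns ] (All Proper Ns × Qs ↭ Ns ++ replicate k (X^ 1))
splitX [] = 0 , [] , [] , ↭.↭-refl
splitX (irr ∷ irrs) with splitX irrs | X-or-proper irr
... | k , Ns , proper , p | inj₁ Q≈X = suc k , Ns , proper ,
  ↭.↭-trans (↭.prep Q≈X p) (↭.↭-sym (↭.↭-shift Ns (replicate k (X^ 1))))
... | k , Ns , proper , p | inj₂ Q-proper = k , _ ∷ Ns , Q-proper ∷ proper , ↭.↭-prep _ p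

∏-splitX : ∀ {Qs} Ns k → Qs ↭ Ns ++ replicate k (X^ 1) → ∏ Qs ≈ X^ k ⊗ ∏ Ns
∏-splitX Ns k p = ≈-trans (∏-↭ p) (≈-trans (∏-++ Ns (replicate k (X^ 1)))
  (≈-trans (⊗-congˡ (∏ Ns) (∏-replicate-X k)) (⊗-comm (∏ Ns) (X^ k))))

-- The constant terms being nonzero, `k` and `l` are the orders of vanishing at 0.
X^-unique : ∀ k l {p q} → coeff p 0 ≢ 0 → coeff q 0 ≢ 0 → X^ k ⊗ p ≈ X^ l ⊗ q → k ≡ l × p ≈ q
X^-unique zero zero {p} {q} _ _ e =
  refl , ≈-trans (≈-sym (⊗-identityˡ p)) (≈-trans e (⊗-identityˡ q))
X^-unique zero (suc l) {p} {q} p₀≢0 _ e = ⊥-elim (p₀≢0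
  (coeff-≡ (≈-trans (≈-sym (⊗-identityˡ p)) (≈-trans e (0∷-⊗ (X^ l) q))) 0))
X^-unique (suc k) zero {p} {q} _ q₀≢0 e = ⊥-elim (q₀≢0
  (coeff-≡ (≈-trans (≈-sym (⊗-identityˡ q)) (≈-trans (≈-sym e) (0∷-⊗ (X^ k) p))) 0))
X^-unique (suc k) (suc l) {p} {q} p₀≢0 q₀≢0 e
  with k≡l , p≈q ← X^-unique k l p₀≢0 q₀≢0
    (tail-cong (≈-trans (≈-sym (0∷-⊗ (X^ k) p)) (≈-trans e (0∷-⊗ (X^ l) q))))
  = cong suc k≡l , p≈q

∏-coeff-0 : ∀ {Ns} → All Proper Ns → coeff (∏ Ns) 0 ≢ 0
∏-coeff-0 [] ()
∏-coeff-0 {N ∷ Ns} ((_ , N₀≢0) ∷ proper) e =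
  [ N₀≢0 , ∏-coeff-0 proper ]′ (ℕₚ.m*n≡0⇒m≡0∨n≡0 _ (trans (sym (coeff-⊗-0 N (∏ Ns))) e))

-- Proper factors of a polynomial with value 10

value-X^ : ∀ k → value (X^ k) ≡ 1
value-X^ zero    = refl
value-X^ (suc k) = trans (value-∷ 0 (X^ k)) (value-X^ k)

proper-value : ∀ N → Proper N → 2 ℕ.≤ value N
proper-value [] (_ , N₀≢0) = ⊥-elim (N₀≢0 refl)
proper-value (zero ∷ p) (_ , N₀≢0) = ⊥-elim (N₀≢0 refl)
proper-value (suc (suc a) ∷ p) _ = s≤s (s≤s z≤n)
proper-value (1 ∷ p) ((_ , N≉1 , _) , _) = subst (2 ℕ.≤_) (sym (value-∷ 1 p))
  (s≤s (ℕₚ.n≢0⇒n>0 λ v≡0 → N≉1 (∷-cong refl (value≡0⇒≈0 p v≡0))))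

∏-value : ∀ {N Ns} → All Proper (N ∷ Ns) → 2 ℕ.≤ value (∏ (N ∷ Ns))
∏-value {N} {Ns} (N-proper ∷ proper) = subst (2 ℕ.≤_) (sym (value-⊗ N (∏ Ns)))
  (ℕₚ.*-mono-≤ {2} {value N} {1} (proper-value N N-proper) (positive proper))
  where
  positive : ∀ {Ns} → All Proper Ns → 1 ℕ.≤ value (∏ Ns)
  positive []               = s≤s z≤n
  positive ps@(_ ∷ _) = ℕₚ.<⇒≤ (∏-value ps)

-- Each factor is at most `n` because the other is positive, so a table over `upTo (suc n)`
-- suffices.
boundedProducts : ∀ n (P : ℕ → ℕ → Set) →
  All (λ a → All (λ b → 2 ℕ.≤ a → 2 ℕ.≤ b → a ℕ.* b ≡ n → P a b) (upTo (suc n))) (upTo (suc n)) →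
  ∀ a b → 2 ℕ.≤ a → 2 ℕ.≤ b → a ℕ.* b ≡ n → P a b
boundedProducts n P table a b 2≤a 2≤b ab≡n = lookup (lookup table
  (∈-upTo⁺ (s≤s (subst (a ℕ.≤_) ab≡n (ℕₚ.m≤m*n a b {{ℕ.>-nonZero (ℕₚ.<⇒≤ 2≤b)}})))))
  (∈-upTo⁺ (s≤s (subst (b ℕ.≤_) ab≡n (ℕₚ.m≤n*m b a {{ℕ.>-nonZero (ℕₚ.<⇒≤ 2≤a)}})))) 2≤a 2≤b ab≡n

opaque
  tenSplit : ∀ a b → 2 ℕ.≤ a → 2 ℕ.≤ b → a ℕ.* b ≡ 10 → (a ≡ 2 × b ≡ 5) ⊎ (a ≡ 5 × b ≡ 2)
  tenSplit = boundedProducts 10 _ (from-yes (all? (λ a → all? (λ b →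
    (2 ℕₚ.≤? a) →-dec (2 ℕₚ.≤? b) →-dec (a ℕ.* b ℕₚ.≟ 10) →-dec
    (((a ℕₚ.≟ 2) ×-dec (b ℕₚ.≟ 5)) ⊎-dec ((a ℕₚ.≟ 5) ×-dec (b ℕₚ.≟ 2))))
    (upTo 11)) (upTo 11)))

opaque
  noFiveSplit : ∀ a b → 2 ℕ.≤ a → 2 ℕ.≤ b → a ℕ.* b ≡ 5 → ⊥
  noFiveSplit = boundedProducts 5 _ (from-yes (all? (λ a → all? (λ b →
    (2 ℕₚ.≤? a) →-dec (2 ℕₚ.≤? b) →-dec (a ℕ.* b ℕₚ.≟ 5) →-dec no λ ())
    (upTo 6)) (upTo 6)))

opaque
  noTwoSplit : ∀ a b → 2 ℕ.≤ a → 2 ℕ.≤ b → a ℕ.* b ≡ 2 → ⊥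
  noTwoSplit = boundedProducts 2 _ (from-yes (all? (λ a → all? (λ b →
    (2 ℕₚ.≤? a) →-dec (2 ℕₚ.≤? b) →-dec (a ℕ.* b ℕₚ.≟ 2) →-dec no λ ())
    (upTo 3)) (upTo 3)))

-- Proper factors have value at least 2, and 10 is not a product of three such numbers. In
-- `binomial` the factor of value 2 is listed first.
data Shape (Ns : List N₁) : Set where
  irreducible : ∀ Q → Ns ≡ [ Q ] → Proper Q → Shape Ns
  binomial    : ∀ A B → Ns ↭ A ∷ B ∷ [] → Proper A → Proper B → value A ≡ 2 → Shape Ns

shape : ∀ Ns → All Proper Ns → value (∏ Ns) ≡ 10 → Shape Ns
shape (Q ∷ []) (Q-proper ∷ []) _ = irreducible Q refl Q-proper
shape (A ∷ B ∷ []) (A-proper ∷ B-proper ∷ []) e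
  with tenSplit (value A) (value B) (proper-value A A-proper) (proper-value B B-proper)
    (trans (sym (trans (value-⊗ A (B ⊗ 1#)) (cong (value A ℕ.*_) (value-cong _ _ (⊗-identityʳ B))))) e)
... | inj₁ (A≡2 , _) = binomial A B ↭.↭-refl A-proper B-proper A≡2
... | inj₂ (_ , B≡2) = binomial B A (↭.↭-swap A B ↭.↭-refl) B-proper A-proper B≡2
shape (A ∷ B ∷ C ∷ Ns) (A-proper ∷ B-proper ∷ proper) e = ⊥-elim (impossible
  (tenSplit (value A) (value (∏ (B ∷ C ∷ Ns))) (proper-value A A-proper) (∏-value (B-proper ∷ proper))
    (trans (sym (value-⊗ A (∏ (B ∷ C ∷ Ns)))) e)))
  where
  BC : value (∏ (B ∷ C ∷ Ns)) ≡ value B ℕ.* value (∏ (C ∷ Ns))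
  BC = value-⊗ B (∏ (C ∷ Ns))
  impossible : (value A ≡ 2 × value (∏ (B ∷ C ∷ Ns)) ≡ 5) ⊎ (value A ≡ 5 × value (∏ (B ∷ C ∷ Ns)) ≡ 2) → ⊥
  impossible (inj₁ (_ , BC≡5)) =
    noFiveSplit _ _ (proper-value B B-proper) (∏-value proper) (trans (sym BC) BC≡5)
  impossible (inj₂ (_ , BC≡2)) =
    noTwoSplit _ _ (proper-value B B-proper) (∏-value proper) (trans (sym BC) BC≡2)

-- Binomial factors

HasBinomial : List ℕ → ℕ → Set
HasBinomial E m = ∃[ B ] E ↭ₚ pairs (m ℕ.+_) B

Ambiguous : List ℕ → Set
Ambiguous E = ∃[ m ] ∃[ n ] (m < n × HasBinomial E m × HasBinomial E n)

hasBinomial : ∀ {P m} S → P ≈ (1# ⊕ X^ m) ⊗ S → HasBinomial (exps P) m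
hasBinomial {P} {m} S e = exps S , mon-injective (exps P) _
  (≈-trans (≈-sym (mon-exps P)) (≈-trans e
    (≈-trans (⊗-congˡ (1# ⊕ X^ m) (mon-exps S)) (binomial-mon m (exps S)))))

-- `m` may be 0: the constant 2 counts as the binomial `1# ⊕ X^ 0`.
value-2 : ∀ A → coeff A 0 ≢ 0 → value A ≡ 2 → ∃[ m ] A ≈ 1# ⊕ X^ m
value-2 []          A₀≢0 _ = ⊥-elim (A₀≢0 refl)
value-2 (zero ∷ p)  A₀≢0 _ = ⊥-elim (A₀≢0 refl)
value-2 (suc a ∷ p) _    e
  -- This list is `exps (suc a ∷ p)` without its first exponent 0; the total length 2 leaves a
  -- single entry.
  with replicate a 0 ++ map suc (exps p) | mon-exps (suc a ∷ p) | trans (length-exps (suc a ∷ p)) e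
... | m ∷ [] | A≈ | _ = m , ≈-trans A≈ (⊕-cong (≈-refl {1#}) (⊕-identityʳ (X^ m)))

-- Candidates for `m`. Truncated subtraction may add spurious ones, but each candidate is tested.
exponentDifferences : List ℕ → List ℕ
exponentDifferences E = cartesianProductWith ℕ._∸_ E E

module _ {k} {E : List ℕ} (|E| : length E ≡ suc k ℕ.* 2) where

  cofactor-length : ∀ {m} B → E ↭ₚ pairs (m ℕ.+_) B → length B ≡ suc k
  cofactor-length B p = ℕₚ.*-cancelʳ-≡ (length B) (suc k) 2
    (trans (sym (length-pairs _ B)) (trans (sym (Perm.↭-length p)) |E|))

  -- The base points of a matching lie in `E` and are half as many, so searching the lists of
  -- `suc k` members of `E` is exhaustive.
  hasBinomial? : ∀ m → Dec (HasBinomial E m)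
  hasBinomial? m = map′ (λ any → let B , _ , p = find any in B , p)
    (λ (B , p) → lose (subst (λ l → B ∈ tuples E l) (cofactor-length B p)
      (∈-tuples (tabulate λ x∈B → Perm.∈-resp-↭ (↭-sym p) (proj₁ (∈-pairs (m ℕ.+_) x∈B))))) p)
    (any? (λ B → permutation? ℕₚ._≟_ E (pairs (m ℕ.+_) B)) (tuples E (suc k)))

  ∈-exponentDifferences : ∀ {m} → HasBinomial E m → m ∈ exponentDifferences E
  ∈-exponentDifferences {m} ([] , p) with () ← cofactor-length {m} [] p
  ∈-exponentDifferences {m} (b ∷ B , p) = subst (_∈ exponentDifferences E) (ℕₚ.m+n∸n≡m m b)
    (∈-cartesianProductWith⁺ ℕ._∸_
      (Perm.∈-resp-↭ (↭-sym p) (there (here refl))) (Perm.∈-resp-↭ (↭-sym p) (here refl)))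

  -- Supplies the witnesses `m`, `n` and both matchings that a bare negation of uniqueness does not.
  ambiguous? : Dec (Ambiguous E)
  ambiguous? = map′
    (λ any → let m , _ , any′ = find any ; n , _ , r = find any′ in m , n , r)
    (λ (m , n , r@(_ , bm , bn)) → lose (∈-exponentDifferences bm) (lose (∈-exponentDifferences bn) r))
    (any? (λ m → any? (λ n → (m ℕₚ.<? n) ×-dec hasBinomial? m ×-dec hasBinomial? n)
      (exponentDifferences E)) (exponentDifferences E))

-- Uniqueness in the absence of two binomial factors

module _ {P : N₁} (unambiguous : ¬ Ambiguous (exps P)) where

  binomial-unique : ∀ {m n} S T → P ≈ (1# ⊕ X^ m) ⊗ S → P ≈ (1# ⊕ X^ n) ⊗ T → m ≡ n
  binomial-unique {m} {n} S T e f with ℕₚ.<-cmp m n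
  ... | tri< m<n _ _ = ⊥-elim (unambiguous (m , n , m<n , hasBinomial S e , hasBinomial T f))
  ... | tri≈ _ m≡n _ = m≡n
  ... | tri> _ _ n<m = ⊥-elim (unambiguous (n , m , n<m , hasBinomial T f , hasBinomial S e))

  reducible-absurd : ∀ {Q A B} → Proper Q → Proper A → Proper B → Q ≈ A ⊗ B → ⊥
  reducible-absurd {A = A} {B} ((_ , _ , split) , _) ((_ , A≉1 , _) , _) ((_ , B≉1 , _) , _) e =
    [ A≉1 , B≉1 ]′ (split A B e)

  -- Two binomial factors must coincide, and then so do their cofactors by cancellation. The power
  -- `X^ k` is carried along because unambiguity concerns the exponents of `P`, not those of `∏ Ns`.
  ∏-unique : ∀ {Ns Ms} k → P ≈ X^ k ⊗ ∏ Ns → ∏ Ns ≈ ∏ Ms → Shape Ns → Shape Ms → Ns ↭ Ms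
  ∏-unique k _ e (irreducible Q refl _) (irreducible R refl _) =
    ↭.prep (≈-trans (≈-sym (⊗-identityʳ Q)) (≈-trans e (⊗-identityʳ R))) ↭.↭-refl
  ∏-unique k _ e (irreducible Q refl Q-proper) (binomial A B p A-proper B-proper _) =
    ⊥-elim (reducible-absurd Q-proper A-proper B-proper (≈-trans (≈-sym (⊗-identityʳ Q))
      (≈-trans e (≈-trans (∏-↭ p) (⊗-congˡ A (⊗-identityʳ B))))))
  ∏-unique k _ e (binomial A B p A-proper B-proper _) (irreducible Q refl Q-proper) =
    ⊥-elim (reducible-absurd Q-proper A-proper B-proper (≈-trans (≈-sym (⊗-identityʳ Q))
      (≈-trans (≈-sym e) (≈-trans (∏-↭ p) (⊗-congˡ A (⊗-identityʳ B))))))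
  ∏-unique {Ns} {Ms} k P≈ e (binomial A B p A-proper _ A≡2) (binomial A′ B′ p′ A′-proper _ A′≡2)
    with m , A≈ ← value-2 A (proj₂ A-proper) A≡2
    with n , A′≈ ← value-2 A′ (proj₂ A′-proper) A′≡2
    = ↭.↭-trans p (↭.↭-trans (↭.prep A≈A′ (↭.prep B≈B′ ↭.↭-refl)) (↭.↭-sym p′))
    where
    factor : ∀ l {Ls} A B → A ≈ 1# ⊕ X^ l → Ls ↭ A ∷ B ∷ [] → P ≈ X^ k ⊗ ∏ Ls →
             P ≈ (1# ⊕ X^ l) ⊗ (X^ k ⊗ (B ⊗ 1#))
    factor l A B A≈ p P≈ = ≈-trans P≈ (≈-trans (⊗-congˡ (X^ k) (∏-↭ p))
      (≈-trans (⊗-leftSwap (X^ k) A (B ⊗ 1#)) (⊗-cong A≈ ≈-refl)))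
    m≡n : m ≡ n
    m≡n = binomial-unique (X^ k ⊗ (B ⊗ 1#)) (X^ k ⊗ (B′ ⊗ 1#))
      (factor m A B A≈ p P≈) (factor n A′ B′ A′≈ p′ (≈-trans P≈ (⊗-congˡ (X^ k) e)))
    A≈A′ : A ≈ A′
    A≈A′ = ≈-trans A≈ (≈-trans (≈-reflexive (cong (λ m → 1# ⊕ X^ m) m≡n)) (≈-sym A′≈))
    B≈B′ : B ≈ B′
    B≈B′ = ⊗-cancelˡ A (proj₂ A-proper) (begin
      A ⊗ B            ≈⟨ ⊗-congˡ A (⊗-identityʳ B) ⟨
      ∏ (A ∷ B ∷ [])   ≈⟨ ∏-↭ p ⟨
      ∏ Ns             ≈⟨ e ⟩
      ∏ Ms             ≈⟨ ∏-↭ p′ ⟩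
      ∏ (A′ ∷ B′ ∷ []) ≈⟨ ⊗-cong (≈-sym A≈A′) (⊗-identityʳ B′) ⟩
      A ⊗ B′           ∎)
      where open ≈-Reasoning

  unambiguous⇒unique : value P ≡ 10 → UniqueFactorisation P
  unambiguous⇒unique P≡10 Qs Rs (irrQ , P≈Q) (irrR , P≈R)
    with k , Ns , properN , p ← splitX irrQ
    with l , Ms , properM , q ← splitX irrR
    with P≈N ← ≈-trans P≈Q (∏-splitX Ns k p)
    with P≈M ← ≈-trans P≈R (∏-splitX Ms l q)
    with refl , N≈M ← X^-unique k l (∏-coeff-0 properN) (∏-coeff-0 properM) (≈-trans (≈-sym P≈N) P≈M)
    = ↭.↭-trans p (↭.↭-trans (↭.++⁺ʳ (replicate k (X^ 1)) Ns↭Ms) (↭.↭-sym q))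
    where
    N≡10 : value (∏ Ns) ≡ 10
    N≡10 = trans (sym (trans (value-⊗ (X^ k) (∏ Ns)) (trans
      (cong (ℕ._* value (∏ Ns)) (value-X^ k)) (ℕₚ.*-identityˡ _))))
                 (trans (sym (value-cong _ _ P≈N)) P≡10)
    Ns↭Ms : Ns ↭ Ms
    Ns↭Ms = ∏-unique k P≈N N≈M (shape Ns properN N≡10)
      (shape Ms properM (trans (sym (value-cong _ _ N≈M)) N≡10))

-- From integer back to natural exponents

scaledℕ : ℕ → ℕ → ℕ → ℕ
scaledℕ x d e = x ℕ.+ e ℕ.* d

map-scaled : ∀ x d O → map (scaled (+ x) d) (map +_ O) ≡ map +_ (map (scaledℕ x d) O)
map-scaled x d O = trans (sym (Listₚ.map-∘ O)) (trans
  (Listₚ.map-cong (λ e → cong (ℤ._+_ (+ x)) (sym (ℤₚ.pos-* e d))) O) (Listₚ.map-∘ O))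

map-+-injective : ∀ E F → map +_ E ↭ₚ map +_ F → E ↭ₚ F
map-+-injective E F p = subst₂ _↭ₚ_ (retract E) (retract F) (Perm.map⁺ ∣_∣ p)
  where
  retract : ∀ E → map ∣_∣ (map +_ E) ≡ E
  retract E = trans (sym (Listₚ.map-∘ E)) (Listₚ.map-id E)

-- The offset is itself a member of the progression, hence equal to an exponent in `B`.
base-natural : ∀ {B x d bs} → map +_ B ↭ₚ bs → scaled x d (+ 0) ∈ bs → ∃[ x′ ] x ≡ + x′
base-natural {x = x} p x∈ with b , _ , eq ← ∈-map⁻ +_ (Perm.∈-resp-↭ (↭-sym p) x∈) =
  b , trans (sym (ℤₚ.+-identityʳ x)) eq

naturalProgression : ∀ {B x d} O → map +_ B ↭ₚ map (scaled x d) (map +_ (0 ∷ O)) →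
                     ∃[ x′ ] B ↭ₚ map (scaledℕ x′ d) (0 ∷ O)
naturalProgression {B} {x} {d} O p with x′ , refl ← base-natural {B} {x} {d} p (here refl) =
  x′ , map-+-injective B _ (↭-trans p (↭-reflexive (map-scaled x′ d (0 ∷ O))))

naturalProgressions : ∀ {B x y d} O O′ →
  map +_ B ↭ₚ map (scaled x d) (map +_ (0 ∷ O)) ++ map (scaled y d) (map +_ (0 ∷ O′)) →
  ∃[ x′ ] ∃[ y′ ] B ↭ₚ map (scaledℕ x′ d) (0 ∷ O) ++ map (scaledℕ y′ d) (0 ∷ O′)
naturalProgressions {B} {x} {y} {d} O O′ p
  with x′ , refl ← base-natural {B} {x} {d} p (here refl)
  with y′ , refl ← base-natural {B} {y} {d} p (Perm.∈-resp-↭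
    (Perm.++-comm (map (scaled y d) (map +_ (0 ∷ O′))) (map (scaled (+ x′) d) (map +_ (0 ∷ O))))
    (here refl))
  = x′ , y′ , map-+-injective B _ (↭-trans p (↭-reflexive (trans
      (cong₂ _++_ (map-scaled x′ d (0 ∷ O)) (map-scaled y′ d (0 ∷ O′)))
      (sym (Listₚ.map-++ +_ (map (scaledℕ x′ d) (0 ∷ O)) (map (scaledℕ y′ d) (0 ∷ O′)))))))

-- The exceptional polynomials

Sporadic Family : N₁ → Set
Sporadic P = ∃[ c ] ∃[ d ] ∃[ Q ] (d ≥ 1 × SporadicQ Q × P ≈ X^ c ⊗ Q ⟨ X^ d ⟩)
Family P   = ∃[ c ] ∃[ a ] ∃[ b ] ∃[ F ] (b ≥ 1 × FamilyF a b F × P ≈ X^ c ⊗ F)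

_↭ℕ?_ : (E F : List ℕ) → Dec (E ↭ₚ F)
_↭ℕ?_ = permutation? ℕₚ._≟_

Q₁ Q₂ Q₃ : N₁
Q₁ = (1# ⊕ X^ 1) ⊗ (1# ⊕ X^ 2 ⊕ X^ 4 ⊕ X^ 6 ⊕ X^ 8)
Q₂ = (1# ⊕ X^ 1) ⊗ (1# ⊕ X^ 4 ⊕ X^ 6 ⊕ X^ 8 ⊕ X^ 12)
Q₃ = (1# ⊕ X^ 3) ⊗ (1# ⊕ X^ 2 ⊕ X^ 4 ⊕ X^ 6 ⊕ X^ 8)

-- In units of `d` from offset `x`, the exponents are those of a concrete `Q`; the implicit argument
-- compares two lists of numerals by evaluation.
sporadic : ∀ {P B} p x d O Q {pairs↭ : True (pairs (p ℕ.+_) O ↭ℕ? exps Q)} →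
           P ≈ (1# ⊕ X^ (p ℕ.* d)) ⊗ mon B → B ↭ₚ map (scaledℕ x d) O → P ≈ X^ x ⊗ Q ⟨ X^ d ⟩
sporadic {P} {B} p x d O Q {pairs↭} P≈ B↭ = begin
  P                                                 ≈⟨ P≈ ⟩
  (1# ⊕ X^ (p ℕ.* d)) ⊗ mon B                       ≈⟨ ⊗-congˡ (1# ⊕ X^ (p ℕ.* d)) (mon-↭ B↭) ⟩
  (1# ⊕ X^ (p ℕ.* d)) ⊗ mon (map (scaledℕ x d) O)   ≈⟨ binomial-mon (p ℕ.* d) (map (scaledℕ x d) O) ⟩
  mon (pairs (p ℕ.* d ℕ.+_) (map (scaledℕ x d) O))  ≡⟨ cong mon (map-pairs (scaledℕ x d) (eq x p d) O) ⟨
  mon (map (scaledℕ x d) (pairs (p ℕ.+_) O))        ≈⟨ mon-↭ (Perm.map⁺ (scaledℕ x d) (toWitness pairs↭)) ⟩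
  mon (map (scaledℕ x d) (exps Q))                  ≡⟨ cong mon (Listₚ.map-∘ (exps Q)) ⟩
  mon (map (x ℕ.+_) (map (ℕ._* d) (exps Q)))        ≈⟨ X^-mon x (map (ℕ._* d) (exps Q)) ⟨
  X^ x ⊗ mon (map (ℕ._* d) (exps Q))                ≈⟨ ⊗-congˡ (X^ x) (substitute-mon d Q) ⟨
  X^ x ⊗ Q ⟨ X^ d ⟩                                 ∎
  where
  open ≈-Reasoning
  eq : ∀ x p d e → x ℕ.+ (p ℕ.+ e) ℕ.* d ≡ p ℕ.* d ℕ.+ (x ℕ.+ e ℕ.* d)
  eq = ℕ-solve-∀

sum-mon : ∀ e₁ e₂ e₃ e₄ →
  1# ⊕ X^ e₁ ⊕ X^ e₂ ⊕ X^ e₃ ⊕ X^ e₄ ≈ mon (0 ∷ e₁ ∷ e₂ ∷ e₃ ∷ e₄ ∷ [])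
sum-mon e₁ e₂ e₃ e₄ = begin
  1# ⊕ X^ e₁ ⊕ X^ e₂ ⊕ X^ e₃ ⊕ X^ e₄
    ≈⟨ ⊕-cong (≈-refl {1# ⊕ X^ e₁ ⊕ X^ e₂ ⊕ X^ e₃}) (⊕-identityʳ (X^ e₄)) ⟨
  1# ⊕ X^ e₁ ⊕ X^ e₂ ⊕ X^ e₃ ⊕ mon (e₄ ∷ [])      ≈⟨ ⊕-assoc (1# ⊕ X^ e₁ ⊕ X^ e₂) (X^ e₃) _ ⟩
  1# ⊕ X^ e₁ ⊕ X^ e₂ ⊕ mon (e₃ ∷ e₄ ∷ [])         ≈⟨ ⊕-assoc (1# ⊕ X^ e₁) (X^ e₂) _ ⟩
  1# ⊕ X^ e₁ ⊕ mon (e₂ ∷ e₃ ∷ e₄ ∷ [])            ≈⟨ ⊕-assoc 1# (X^ e₁) _ ⟩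
  mon (0 ∷ e₁ ∷ e₂ ∷ e₃ ∷ e₄ ∷ [])                ∎
  where open ≈-Reasoning

-- Encoding i a + j b as (i , j) makes permutations of such exponents decidable.
combination : ℕ → ℕ → ℕ × ℕ → ℕ
combination a b (i , j) = i ℕ.* a ℕ.+ j ℕ.* b

translate : ℕ × ℕ → ℕ × ℕ → ℕ × ℕ
translate (i , j) (k , l) = i ℕ.+ k , j ℕ.+ l

combination-pairs : ∀ a b t K → pairs (combination a b t ℕ.+_) (map (combination a b) K) ≡
                                map (combination a b) (pairs (translate t) K)
combination-pairs a b (i , j) K = sym (map-pairs (combination a b) (λ (k , l) → eq a b i j k l) K)
  where
  eq : ∀ a b i j k l → (i ℕ.+ k) ℕ.* a ℕ.+ (j ℕ.+ l) ℕ.* b ≡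
                       i ℕ.* a ℕ.+ j ℕ.* b ℕ.+ (k ℕ.* a ℕ.+ l ℕ.* b)
  eq = ℕ-solve-∀

balance : ∀ a b s t K L {p : True (permutation? (≡-dec ℕₚ._≟_ ℕₚ._≟_)
                                  (pairs (translate s) K) (pairs (translate t) L))} →
  (1# ⊕ X^ (combination a b s)) ⊗ mon (map (combination a b) K) ≈
  (1# ⊕ X^ (combination a b t)) ⊗ mon (map (combination a b) L)
balance a b s t K L {p} = begin
  (1# ⊕ X^ (combination a b s)) ⊗ mon (map (combination a b) K)
    ≈⟨ binomial-mon (combination a b s) (map (combination a b) K) ⟩
  mon (pairs (combination a b s ℕ.+_) (map (combination a b) K))
    ≡⟨ cong mon (combination-pairs a b s K) ⟩
  mon (map (combination a b) (pairs (translate s) K))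
    ≈⟨ mon-↭ (Perm.map⁺ (combination a b) (toWitness p)) ⟩
  mon (map (combination a b) (pairs (translate t) L))
    ≡⟨ cong mon (combination-pairs a b t L) ⟨
  mon (pairs (combination a b t ℕ.+_) (map (combination a b) L))
    ≈⟨ binomial-mon (combination a b t) (map (combination a b) L) ⟨
  (1# ⊕ X^ (combination a b t)) ⊗ mon (map (combination a b) L)   ∎
  where open ≈-Reasoning

family₁ : ∀ a b → (1# ⊕ X^ (3 ℕ.* b)) ⊗ (1# ⊕ X^ a ⊕ X^ b ⊕ X^ (a ℕ.+ b) ⊕ X^ (a ℕ.+ 2 ℕ.* b))
                ≈ (1# ⊕ X^ b) ⊗ (1# ⊕ X^ a ⊕ X^ (a ℕ.+ 2 ℕ.* b) ⊕ X^ (3 ℕ.* b) ⊕ X^ (a ℕ.+ 4 ℕ.* b))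
family₁ a b
  with e ← balance a b (0 , 3) (0 , 1)
         ((0 , 0) ∷ (1 , 0) ∷ (0 , 1) ∷ (1 , 1) ∷ (1 , 2) ∷ [])
         ((0 , 0) ∷ (1 , 0) ∷ (1 , 2) ∷ (0 , 3) ∷ (1 , 4) ∷ [])
  -- `combination` leaves `b + 0`, `a + 0` and, at `(1 , 0)`, `a + 0 + 0`, which needs the rewrite
  -- at `a` twice.
  rewrite ℕₚ.+-identityʳ b | ℕₚ.+-identityʳ a | ℕₚ.+-identityʳ a
  = ≈-trans (⊗-congˡ (1# ⊕ X^ (b ℕ.+ (b ℕ.+ b))) (sum-mon a b (a ℕ.+ b) (a ℕ.+ (b ℕ.+ b)))) (≈-trans e
      (⊗-congˡ (1# ⊕ X^ b) (≈-sym
        (sum-mon a (a ℕ.+ (b ℕ.+ b)) (b ℕ.+ (b ℕ.+ b)) (a ℕ.+ (b ℕ.+ (b ℕ.+ (b ℕ.+ b))))))))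

family₂ : ∀ a b → (1# ⊕ X^ (3 ℕ.* b)) ⊗ (1# ⊕ X^ a ⊕ X^ b ⊕ X^ (a ℕ.+ b) ⊕ X^ (2 ℕ.* b))
                ≈ (1# ⊕ X^ b) ⊗ (1# ⊕ X^ a ⊕ X^ (2 ℕ.* b) ⊕ X^ (a ℕ.+ 3 ℕ.* b) ⊕ X^ (4 ℕ.* b))
family₂ a b
  with e ← balance a b (0 , 3) (0 , 1)
         ((0 , 0) ∷ (1 , 0) ∷ (0 , 1) ∷ (1 , 1) ∷ (0 , 2) ∷ [])
         ((0 , 0) ∷ (1 , 0) ∷ (0 , 2) ∷ (1 , 3) ∷ (0 , 4) ∷ [])
  rewrite ℕₚ.+-identityʳ b | ℕₚ.+-identityʳ a | ℕₚ.+-identityʳ a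
  = ≈-trans (⊗-congˡ (1# ⊕ X^ (b ℕ.+ (b ℕ.+ b))) (sum-mon a b (a ℕ.+ b) (b ℕ.+ b))) (≈-trans e
      (⊗-congˡ (1# ⊕ X^ b) (≈-sym
        (sum-mon a (b ℕ.+ b) (a ℕ.+ (b ℕ.+ (b ℕ.+ b))) (b ℕ.+ (b ℕ.+ (b ℕ.+ b)))))))

module _ {P : N₁} where

  family : ∀ c m {B S} K → P ≈ (1# ⊕ X^ m) ⊗ mon B → B ↭ₚ map (c ℕ.+_) K → S ≈ mon K →
           P ≈ X^ c ⊗ ((1# ⊕ X^ m) ⊗ S)
  family c m {B} {S} K P≈ B↭ S≈ = begin
    P                                      ≈⟨ P≈ ⟩
    (1# ⊕ X^ m) ⊗ mon B                    ≈⟨ ⊗-congˡ (1# ⊕ X^ m) (mon-↭ B↭) ⟩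
    (1# ⊕ X^ m) ⊗ mon (map (c ℕ.+_) K)     ≈⟨ ⊗-congˡ (1# ⊕ X^ m) (X^-mon c K) ⟨
    (1# ⊕ X^ m) ⊗ (X^ c ⊗ mon K)           ≈⟨ ⊗-congˡ (1# ⊕ X^ m) (⊗-congˡ (X^ c) S≈) ⟨
    (1# ⊕ X^ m) ⊗ (X^ c ⊗ S)               ≈⟨ ⊗-leftSwap (1# ⊕ X^ m) (X^ c) S ⟩
    X^ c ⊗ ((1# ⊕ X^ m) ⊗ S)               ∎
    where open ≈-Reasoning

  -- The smaller offset becomes `c` and the gap between the offsets becomes `a`. The first family
  -- arises when the two-term progression starts lowest, the second when the three-term one does.
  progressions : ∀ x y {d B} → d ≥ 1 → P ≈ (1# ⊕ X^ d) ⊗ mon B →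
    B ↭ₚ map (scaledℕ x d) (0 ∷ 2 ∷ 4 ∷ []) ++ map (scaledℕ y d) (0 ∷ 3 ∷ []) → Family P
  progressions x y {d} {B} d≥1 P≈ B↭ with ℕₚ.≤-total y x
  ... | inj₁ y≤x with a , refl ← ℕₚ.m≤n⇒∃[o]m+o≡n y≤x = y , a , d , _ , d≥1 ,
    inj₁ (≈-sym (family₁ a d) , ≈-refl) ,
    family y d _ P≈ B↭′ (sum-mon a (a ℕ.+ 2 ℕ.* d) (3 ℕ.* d) (a ℕ.+ 4 ℕ.* d))
    where
    B↭′ : B ↭ₚ map (y ℕ.+_) (0 ∷ a ∷ a ℕ.+ 2 ℕ.* d ∷ 3 ℕ.* d ∷ a ℕ.+ 4 ℕ.* d ∷ [])
    B↭′ = ↭-trans B↭ (↭-trans (Perm.shift (y ℕ.+ 0) (_ ∷ _ ∷ _ ∷ []) (_ ∷ []))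
      (prep (y ℕ.+ 0) (↭-trans (prep _ (prep _ (swap _ _ ↭-refl))) (↭-reflexive
        (cong₂ _∷_ (ℕₚ.+-identityʳ (y ℕ.+ a)) (cong₂ _∷_ (ℕₚ.+-assoc y a (2 ℕ.* d))
          (cong₂ _∷_ refl (cong₂ _∷_ (ℕₚ.+-assoc y a (4 ℕ.* d)) refl))))))))
  ... | inj₂ x≤y with a , refl ← ℕₚ.m≤n⇒∃[o]m+o≡n x≤y = x , a , d , _ , d≥1 ,
    inj₂ (≈-sym (family₂ a d) , ≈-refl) ,
    family x d _ P≈ B↭′ (sum-mon a (2 ℕ.* d) (a ℕ.+ 3 ℕ.* d) (4 ℕ.* d))
    where
    B↭′ : B ↭ₚ map (x ℕ.+_) (0 ∷ a ∷ 2 ℕ.* d ∷ a ℕ.+ 3 ℕ.* d ∷ 4 ℕ.* d ∷ [])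
    B↭′ = ↭-trans B↭ (prep (x ℕ.+ 0) (↭-trans (Perm.shift (x ℕ.+ a ℕ.+ 0) (_ ∷ _ ∷ []) (_ ∷ []))
      (↭-trans (prep _ (prep _ (swap _ _ ↭-refl))) (↭-reflexive
        (cong₂ _∷_ (ℕₚ.+-identityʳ (x ℕ.+ a)) (cong₂ _∷_ refl
          (cong₂ _∷_ (ℕₚ.+-assoc x a (3 ℕ.* d)) refl)))))))

  exceptional : ∀ m B → P ≈ (1# ⊕ X^ m) ⊗ mon B → Cofactor m (map +_ B) → Sporadic P ⊎ Family P
  exceptional m B P≈ (d , d≥1 , inj₁ (refl , x , y , p))
    with x′ , y′ , B↭ ← naturalProgressions {B} {x} {y} {d} (2 ∷ 4 ∷ []) (3 ∷ []) p
    = inj₂ (progressions x′ y′ d≥1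
        (subst (λ m → P ≈ (1# ⊕ X^ m) ⊗ mon B) (ℕₚ.*-identityˡ d) P≈) B↭)
  exceptional m B P≈ (d , d≥1 , inj₂ (inj₁ (refl , x , inj₁ p)))
    with x′ , B↭ ← naturalProgression {B} {x} {d} (2 ∷ 4 ∷ 6 ∷ 8 ∷ []) p
    -- Both displayed products evaluate to the same coefficient list, so `refl` compares them.
    = inj₁ (x′ , d , Q₁ , d≥1 , inj₁ (≈-refl , mk≈ λ _ → refl) ,
        sporadic 1 x′ d (0 ∷ 2 ∷ 4 ∷ 6 ∷ 8 ∷ []) Q₁ P≈ B↭)
  exceptional m B P≈ (d , d≥1 , inj₂ (inj₁ (refl , x , inj₂ p)))
    with x′ , B↭ ← naturalProgression {B} {x} {d} (4 ∷ 6 ∷ 8 ∷ 12 ∷ []) p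
    = inj₁ (x′ , d , Q₂ , d≥1 , inj₂ (inj₁ (≈-refl , mk≈ λ _ → refl)) ,
        sporadic 1 x′ d (0 ∷ 4 ∷ 6 ∷ 8 ∷ 12 ∷ []) Q₂ P≈ B↭)
  exceptional m B P≈ (d , d≥1 , inj₂ (inj₂ (refl , x , p)))
    with x′ , B↭ ← naturalProgression {B} {x} {d} (2 ∷ 4 ∷ 6 ∷ 8 ∷ []) p
    = inj₁ (x′ , d , Q₃ , d≥1 , inj₂ (inj₂ (≈-refl , mk≈ λ _ → refl)) ,
        sporadic 3 x′ d (0 ∷ 2 ∷ 4 ∷ 6 ∷ 8 ∷ []) Q₃ P≈ B↭)

mainTheorem12 : (P : N₁) → eval P 1 ≡ 10 → ¬ UniqueFactorisation P →
    (∃[ c ] ∃[ d ] ∃[ Q ] (d ≥ 1 × SporadicQ Q × P ≈ X^ c ⊗ Q ⟨ X^ d ⟩))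
    ⊎ (∃[ c ] ∃[ a ] ∃[ b ] ∃[ F ] (b ≥ 1 × FamilyF a b F × P ≈ X^ c ⊗ F))
-- Ten exponents form `suc 4` pairs.
mainTheorem12 P P≡10 ¬unique with ambiguous? {4} (trans (length-exps P) P≡10)
... | no unambiguous = ⊥-elim (¬unique (unambiguous⇒unique unambiguous P≡10))
... | yes (m , n , m<n , (B , p) , (B′ , q)) = exceptional m B P≈
  (cofactor m<n (map +_ B) (map +_ B′) |B|≡5 balanced)
  where
  P≈ : P ≈ (1# ⊕ X^ m) ⊗ mon B
  P≈ = ≈-trans (mon-exps P) (≈-trans (mon-↭ p) (≈-sym (binomial-mon m B)))
  |B|≡5 : length (map +_ B) ≡ 5
  |B|≡5 = trans (Listₚ.length-map +_ B) (cofactor-length (trans (length-exps P) P≡10) B p)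
  balanced : pairs (ℤ._+_ (+ m)) (map +_ B) ↭ₚ pairs (ℤ._+_ (+ n)) (map +_ B′)
  balanced = subst₂ _↭ₚ_ (map-pairs +_ (λ _ → refl) B) (map-pairs +_ (λ _ → refl) B′)
    (Perm.map⁺ +_ (↭-trans (↭-sym p) q))
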